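{- For every integer $n \geq 373$, $p_{od}^{eu}(n) < p_{eu}^{od}(n)$.
   Context: A partition of a positive integer $n$ is a finite non-increasing sequence of positive integers (its parts) summing to $n$. Let $p_{od}^{eu}(n)$ denote the number of partitions of $n$ in which every even part is strictly larger than every odd part, even parts may be repeated arbitrarily, and odd parts are distinct. Let $p_{eu}^{od}(n)$ denote the number of partitions of $n$ in which every odd part is strictly larger than every even part, odd parts are distinct, and even parts may be repeated arbitrarily. In both cases, partitions with no even parts or with no odd parts are allowed. -}

module Defs where

open import Data.Nat using (ℕ; zero; suc; _+_; _∸_; _≤_; _<_; _≥_; z≤n; s≤s; _≤?_; _<?_; _≟_)
open import Data.Nat.Properties
  using (≤-refl; ≤-trans; m≤m+n; m≤n⇒m≤1+n; m+[n∸m]≡n; m+n∸m≡n; suc-injective; <-irrefl; m≤n⇒m<n∨m≡n; +-mono-≤)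
open import Data.Nat.Divisibility using (_∣_; _∣?_)
open import Data.List using (List; []; _∷_; _++_; map; filter; length)
open import Data.Nat.ListAction using (sum)
open import Data.List.Properties using (∷-injectiveʳ)
open import Data.List.Relation.Unary.All as All using (All; []; _∷_; all?)
open import Data.List.Relation.Unary.Any using (here)
open import Data.List.Relation.Unary.AllPairs using ([]; _∷_)
open import Data.List.Relation.Unary.Linked as Linked using (Linked; []; [-]; _∷_)
open import Data.List.Relation.Unary.Unique.Propositional using (Unique)
open import Data.List.Relation.Unary.Unique.Propositional.Properties using (++⁺; map⁺)
open import Data.List.Relation.Unary.Unique.DecPropositional _≟_ using (unique?)
open import Data.List.Membership.Propositional using (_∈_)
open import Data.List.Membership.Propositional.Properties using (∈-++⁺ˡ; ∈-++⁺ʳ; ∈-++⁻; ∈-map⁺; ∈-map⁻)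
open import Data.Product using (_×_; _,_; proj₁; proj₂)
open import Data.Sum using (inj₁; inj₂)
open import Data.Empty using (⊥-elim)
open import Relation.Nullary using (¬_; yes; no)
open import Relation.Nullary.Decidable using (¬?; _×-dec_; _→-dec_)
open import Relation.Unary using (Pred; Decidable)
open import Relation.Binary.PropositionalEquality using (_≡_; refl; sym; trans; cong; subst)
open import Level using (0ℓ)

record IsPartition (n : ℕ) (xs : List ℕ) : Set where
  constructor isPartition
  field
    nonIncreasing : Linked _≥_ xs
    positive      : All (1 ≤_) xs
    sum≡          : sum xs ≡ n

-- The partitions of n into at most k parts, each at most m.
boxed : (k m n : ℕ) → List (List ℕ)
boxed _       _       zero    = [] ∷ []
boxed zero    _       (suc n) = []
boxed (suc k) zero    (suc n) = []
boxed (suc k) (suc m) (suc n) with m ≤? n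
... | yes _ = boxed (suc k) m (suc n) ++ map (suc m ∷_) (boxed k (suc m) (n ∸ m))
... | no  _ = boxed (suc k) m (suc n)

partitions : ℕ → List (List ℕ)
partitions n = boxed n n n

Even Odd : Pred ℕ 0ℓ
Even a = 2 ∣ a
Odd  a = ¬ (2 ∣ a)

even? : Decidable Even
even? a = 2 ∣? a

odd? : Decidable Odd
odd? a = ¬? (even? a)

EvensAboveOdds OddsAboveEvens DistinctOdds : Pred (List ℕ) 0ℓ
EvensAboveOdds xs = All (λ a → All (λ b → Even a → Odd b → b < a) xs) xs
OddsAboveEvens xs = All (λ a → All (λ b → Odd a → Even b → b < a) xs) xs
DistinctOdds   xs = Unique (filter odd? xs)

evensAboveOdds? : Decidable EvensAboveOdds
evensAboveOdds? xs = all? (λ a → all? (λ b → even? a →-dec (odd? b →-dec (b <? a))) xs) xs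

oddsAboveEvens? : Decidable OddsAboveEvens
oddsAboveEvens? xs = all? (λ a → all? (λ b → odd? a →-dec (even? b →-dec (b <? a))) xs) xs

distinctOdds? : Decidable DistinctOdds
distinctOdds? xs = unique? (filter odd? xs)

#partitions : {P : Pred (List ℕ) 0ℓ} → Decidable P → ℕ → ℕ
#partitions P? n = length (filter P? (partitions n))

-- The superscript names the parity of the larger parts, the subscript that of the smaller ones.
p-od^eu p-eu^od : ℕ → ℕ
p-od^eu = #partitions (λ xs → evensAboveOdds? xs ×-dec distinctOdds? xs)
p-eu^od = #partitions (λ xs → oddsAboveEvens? xs ×-dec distinctOdds? xs)

-- The lemmas below show that partitions n lists each partition of n exactly once.

linked-cons : ∀ {x xs} → All (_≤ x) xs → Linked _≥_ xs → Linked _≥_ (x ∷ xs)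
linked-cons []       []         = [-]
linked-cons (p ∷ _)  l          = p ∷ l

linked-bound : ∀ {x xs} → Linked _≥_ (x ∷ xs) → All (_≤ x) xs
linked-bound [-]     = []
linked-bound (p ∷ l) = p ∷ All.map (λ q → ≤-trans q p) (linked-bound l)

boxed-sound : ∀ k m n {xs} → xs ∈ boxed k m n → IsPartition n xs × All (_≤ m) xs
boxed-sound zero    m       zero    (here refl) = isPartition [] [] refl , []
boxed-sound (suc k) m       zero    (here refl) = isPartition [] [] refl , []
boxed-sound (suc k) (suc m) (suc n) xs∈ with m ≤? n
... | no  _ with boxed-sound (suc k) m (suc n) xs∈
...   | p , b = p , All.map m≤n⇒m≤1+n b
boxed-sound (suc k) (suc m) (suc n) xs∈ | yes m≤n
  with ∈-++⁻ (boxed (suc k) m (suc n)) xs∈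
... | inj₁ l with boxed-sound (suc k) m (suc n) l
...   | p , b = p , All.map m≤n⇒m≤1+n b
boxed-sound (suc k) (suc m) (suc n) xs∈ | yes m≤n | inj₂ r
  with ∈-map⁻ (suc m ∷_) r
... | ys , ys∈ , refl with boxed-sound k (suc m) (n ∸ m) ys∈
...   | isPartition l p s , b =
  isPartition (linked-cons b l) (s≤s z≤n ∷ p)
              (cong suc (trans (cong (m +_) s) (m+[n∸m]≡n m≤n)))
  , ≤-refl ∷ b

boxed-complete : ∀ k m n {xs} → IsPartition n xs → All (_≤ m) xs → length xs ≤ k →
                 xs ∈ boxed k m n
boxed-complete zero    m       zero {[]} _ _ _ = here refl
boxed-complete (suc k) m       zero {[]} _ _ _ = here refl
boxed-complete _       _       zero {suc x ∷ xs} (isPartition _ _ ()) _ _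
boxed-complete _       _       zero {zero ∷ xs} (isPartition _ (() ∷ _) _) _ _
boxed-complete _       _       (suc n) {[]} (isPartition _ _ ()) _ _
boxed-complete (suc k) zero    (suc n) {zero ∷ xs} (isPartition _ (() ∷ _) _) _ _
boxed-complete (suc k) zero    (suc n) {suc x ∷ xs} _ (() ∷ _) _
boxed-complete (suc k) (suc m) (suc n) {x ∷ xs} π@(isPartition l (p ∷ ps) s) (b ∷ bs) (s≤s len)
  with m ≤? n | m≤n⇒m<n∨m≡n b
... | yes _ | inj₁ (s≤s x≤m) =
  ∈-++⁺ˡ (boxed-complete (suc k) m (suc n) π
            (x≤m ∷ All.map (λ q → ≤-trans q x≤m) (linked-bound l)) (s≤s len))
... | no  _ | inj₁ (s≤s x≤m) =
  boxed-complete (suc k) m (suc n) π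
    (x≤m ∷ All.map (λ q → ≤-trans q x≤m) (linked-bound l)) (s≤s len)
... | yes _ | inj₂ refl =
  ∈-++⁺ʳ (boxed (suc k) m (suc n))
    (∈-map⁺ (suc m ∷_)
      (boxed-complete k (suc m) (n ∸ m)
        (isPartition (Linked.tail l) ps
          (trans (sym (m+n∸m≡n m (sum xs))) (cong (_∸ m) (suc-injective s))))
        bs len))
... | no m≰n | inj₂ refl =
  ⊥-elim (m≰n (subst (m ≤_) (suc-injective s) (m≤m+n m (sum xs))))

boxed-unique : ∀ k m n → Unique (boxed k m n)
boxed-unique zero    m       zero    = [] ∷ []
boxed-unique (suc k) m       zero    = [] ∷ []
boxed-unique zero    m       (suc n) = []
boxed-unique (suc k) zero    (suc n) = []
boxed-unique (suc k) (suc m) (suc n) with m ≤? n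
... | no  _ = boxed-unique (suc k) m (suc n)
... | yes _ = ++⁺ (boxed-unique (suc k) m (suc n))
                  (map⁺ ∷-injectiveʳ (boxed-unique k (suc m) (n ∸ m)))
                  disjoint
  where
  disjoint : ∀ {xs} → ¬ (xs ∈ boxed (suc k) m (suc n) ×
                         xs ∈ map (suc m ∷_) (boxed k (suc m) (n ∸ m)))
  disjoint (l , r) with ∈-map⁻ (suc m ∷_) r
  ... | _ , _ , refl with proj₂ (boxed-sound (suc k) m (suc n) l)
  ...   | m<m ∷ _ = <-irrefl refl m<m

length≤sum : ∀ {xs} → All (1 ≤_) xs → length xs ≤ sum xs
length≤sum []       = z≤n
length≤sum (p ∷ ps) = +-mono-≤ p (length≤sum ps)

parts≤sum : ∀ xs → Linked _≥_ xs → All (_≤ sum xs) xs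
parts≤sum []       _ = []
parts≤sum (x ∷ xs) l =
  m≤m+n x (sum xs) ∷ All.map (λ q → ≤-trans q (m≤m+n x (sum xs))) (linked-bound l)

partitions-sound : ∀ n {xs} → xs ∈ partitions n → IsPartition n xs
partitions-sound n xs∈ = proj₁ (boxed-sound n n n xs∈)

partitions-complete : ∀ n {xs} → IsPartition n xs → xs ∈ partitions n
partitions-complete _ {xs} π@(isPartition l p refl) =
  boxed-complete _ _ _ π (parts≤sum xs l) (length≤sum p)

partitions-unique : ∀ n → Unique (partitions n)
partitions-unique n = boxed-unique n n n

{-# OPTIONS --safe #-}
-- Halving the parts turns both counts into counts of ordinary partitions; write P for their number.
-- If r parts are odd and they exceed all even ones, the halves 2a+1 ↦ a, 2b ↦ b still form a
-- non-increasing list after the staircase r-1, …, 0 is subtracted from the first r of them. Hence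
-- p-eu^od n is the sum of P((n - r²) / 2) over r ≡ n (mod 2), of which three terms are kept.
-- If the even parts exceed the odd ones and r odd parts are 20≤doubler than 1, then the halves form a
-- partition of ⌊(n - r) / 2⌋ in which no part ≤ r is repeated. Asking this only of the parts
-- ≤ min(3, r) bounds p-od^eu n by a sum over r that telescopes to finitely many values of P.
-- For n = 2m or 2m + 1 the difference of the two bounds is thus the m-th coefficient of
-- c(x) / ((1-x)(1-x²)(1-x³)⋯) for a polynomial c with c(1) > 0. Its positivity follows from the
-- recurrence D_k(m) = D_{k-1}(m) + D_k(m-k) for the coefficients of c(x) / ((1-x)⋯(1-x^k)) and a
-- finite table of these coefficients.
module Submission where

open import Defs
open import Data.Nat using (ℕ; _≥_; _<_)

-- Power series with integer coefficients.

module PowerSeries where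

  open import Data.Nat as ℕ using (zero; suc; z≤n; s≤s; _<ᵇ_)
  import Data.Nat.Properties as ℕ
  open import Data.Nat.Induction using (<-rec)
  open import Data.Integer using (ℤ; +_; -_; 0ℤ; 1ℤ; _+_; _*_; _≤_; _≤ᵇ_; +≤+)
  import Data.Integer.Properties as ℤ
  open import Algebra.Properties.CommutativeSemigroup ℤ.+-commutativeSemigroup using (interchange)
  open import Data.List using (List; []; _∷_; length; replicate; _++_)
  open import Data.Bool using (Bool; true; false; _∧_; if_then_else_; T)
  open import Data.Bool.Properties using (T-∧)
  open import Data.Product using (_×_; _,_; proj₁; proj₂)
  open import Data.Sum using (inj₁; inj₂)
  open import Data.Unit using (tt)
  open import Function.Bundles using (Equivalence)
  open import Relation.Nullary using (yes; no; contradiction)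
  open import Relation.Binary.PropositionalEquality

  Seq : Set
  Seq = ℕ → ℤ

  infixl 6 _⊞_
  _⊞_ : Seq → Seq → Seq
  (f ⊞ g) n = f n + g n

  -- Multiplication by x^j.
  shift : ℕ → Seq → Seq
  shift zero    f n       = f n
  shift (suc j) f zero    = 0ℤ
  shift (suc j) f (suc n) = shift j f n

  shift-cong : ∀ j {f g} → f ≗ g → shift j f ≗ shift j g
  shift-cong zero    e n       = e n
  shift-cong (suc j) e zero    = refl
  shift-cong (suc j) e (suc n) = shift-cong j e n

  shift-⊞ : ∀ j f g → shift j (f ⊞ g) ≗ shift j f ⊞ shift j g
  shift-⊞ zero    f g n       = refl
  shift-⊞ (suc j) f g zero    = refl
  shift-⊞ (suc j) f g (suc n) = shift-⊞ j f g n

  shift-* : ∀ j c f → shift j (λ n → c * f n) ≗ λ n → c * shift j f n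
  shift-* zero    c f n       = refl
  shift-* (suc j) c f zero    = sym (ℤ.*-zeroʳ c)
  shift-* (suc j) c f (suc n) = shift-* j c f n

  shift-shift : ∀ i j f → shift i (shift j f) ≗ shift (i ℕ.+ j) f
  shift-shift zero    j f n       = refl
  shift-shift (suc i) j f zero    = refl
  shift-shift (suc i) j f (suc n) = shift-shift i j f n

  shift-comm : ∀ i j f → shift i (shift j f) ≗ shift j (shift i f)
  shift-comm i j f n = begin
    shift i (shift j f) n ≡⟨ shift-shift i j f n ⟩
    shift (i ℕ.+ j) f n   ≡⟨ cong (λ k → shift k f n) (ℕ.+-comm i j) ⟩
    shift (j ℕ.+ i) f n   ≡⟨ shift-shift j i f n ⟨
    shift j (shift i f) n ∎
    where open ≡-Reasoning

  shift-< : ∀ {j n} f → n ℕ.< j → shift j f n ≡ 0ℤ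
  shift-< {suc j} {zero}  f _         = refl
  shift-< {suc j} {suc n} f (s≤s n<j) = shift-< f n<j

  shift-+ : ∀ j f n → shift j f (j ℕ.+ n) ≡ f n
  shift-+ zero    f n = refl
  shift-+ (suc j) f n = shift-+ j f n

  -- Division by 1 - x^(1 + k), computed on rows of coefficients.

  desc : Seq → ℕ → List ℤ
  desc f zero    = []
  desc f (suc n) = f n ∷ desc f n

  nth : ℕ → List ℤ → ℤ
  nth _       []       = 0ℤ
  nth zero    (x ∷ _)  = x
  nth (suc k) (_ ∷ xs) = nth k xs

  nth-desc : ∀ k f n → nth k (desc f n) ≡ shift (suc k) f n
  nth-desc k       f zero    = refl
  nth-desc zero    f (suc n) = refl
  nth-desc (suc k) f (suc n) = nth-desc k f n

  -- A function of its own rather than an inlined expression, so that ys is evaluated only once.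
  prepend : ℕ → ℤ → List ℤ → List ℤ
  prepend k x ys = (x + nth k ys) ∷ ys

  -- Rows carry the highest coefficient first. The quotient of the tail is then already computed,
  -- and its entry k is the coefficient 1 + k places below the head, which is exactly the summand
  -- that the recurrence asks for.
  geoStep : ℕ → List ℤ → List ℤ
  geoStep k []       = []
  geoStep k (x ∷ xs) = prepend k x (geoStep k xs)

  -- g = f / (1 - x^(1 + k))
  Quotient : ℕ → Seq → Seq → Set
  Quotient k f g = g ≗ f ⊞ shift (suc k) g

  -- Stated for any `g` satisfying the quotient relation, so that rows of `conv cs (p k)` can be
  -- computed from the row of `conv cs δ` without ever evaluating `p k`.
  geoStep-desc : ∀ k {f g} → Quotient k f g → ∀ n → geoStep k (desc f n) ≡ desc g n
  geoStep-desc k q zero    = refl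
  geoStep-desc k {f} {g} q (suc n) =
    trans (cong (prepend k (f n)) (geoStep-desc k q n))
            (cong (_∷ desc g n) (trans (cong (λ z → f n + z) (nth-desc k g n)) (sym (q n))))

  geo : ℕ → Seq → Seq
  geo k f n = nth 0 (geoStep k (desc f (suc n)))

  geo-quotient : ∀ k f → Quotient k f (geo k f)
  geo-quotient k f n = cong (λ z → f n + z) (trans (cong (nth k) (rows n)) (nth-desc k (geo k f) n))
    where
    rows : ∀ n → geoStep k (desc f n) ≡ desc (geo k f) n
    rows zero    = refl
    rows (suc n) = cong (geo k f n ∷_) (rows n)

  -- Products of polynomials and power series.

  -- Coefficients, constant term first.
  Poly : Set
  Poly = List ℤ

  dot : Poly → List ℤ → ℤ
  dot []       _        = 0ℤ
  dot (_ ∷ _)  []       = 0ℤ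
  dot (c ∷ cs) (x ∷ xs) = c * x + dot cs xs

  -- The product of a polynomial and a power series; δ is the series 1.
  conv : Poly → Seq → Seq
  conv cs f n = dot cs (desc f (suc n))

  dot-desc : ∀ cs f n → dot cs (desc f n) ≡ shift 1 (conv cs f) n
  dot-desc []       f zero    = refl
  dot-desc (_ ∷ _)  f zero    = refl
  dot-desc cs       f (suc n) = refl

  conv-∷ : ∀ c cs f n → conv (c ∷ cs) f n ≡ c * f n + shift 1 (conv cs f) n
  conv-∷ c cs f n = cong (λ z → c * f n + z) (dot-desc cs f n)

  shift-0 : ∀ j n → shift j (λ _ → 0ℤ) n ≡ 0ℤ
  shift-0 zero    n       = refl
  shift-0 (suc j) zero    = refl
  shift-0 (suc j) (suc n) = shift-0 j n

  conv-cong : ∀ cs {f g} → f ≗ g → conv cs f ≗ conv cs g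
  conv-cong []       e n = refl
  conv-cong (c ∷ cs) {f} {g} e n
    rewrite conv-∷ c cs f n | conv-∷ c cs g n | e n | shift-cong 1 (conv-cong cs e) n = refl

  conv-⊞ : ∀ cs f g → conv cs (f ⊞ g) ≗ conv cs f ⊞ conv cs g
  conv-⊞ []       f g n = refl
  conv-⊞ (c ∷ cs) f g n = begin
    conv (c ∷ cs) (f ⊞ g) n
      ≡⟨ conv-∷ c cs (f ⊞ g) n ⟩
    c * (f n + g n) + shift 1 (conv cs (f ⊞ g)) n
      ≡⟨ cong₂ _+_ (ℤ.*-distribˡ-+ c (f n) (g n))
           (trans (shift-cong 1 (conv-⊞ cs f g) n) (shift-⊞ 1 (conv cs f) (conv cs g) n)) ⟩
    (c * f n + c * g n) + (shift 1 (conv cs f) n + shift 1 (conv cs g) n)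
      ≡⟨ interchange (c * f n) (c * g n) (shift 1 (conv cs f) n) (shift 1 (conv cs g) n) ⟩
    (c * f n + shift 1 (conv cs f) n) + (c * g n + shift 1 (conv cs g) n)
      ≡⟨ cong₂ _+_ (conv-∷ c cs f n) (conv-∷ c cs g n) ⟨
    conv (c ∷ cs) f n + conv (c ∷ cs) g n ∎
    where open ≡-Reasoning

  conv-shift : ∀ cs j f → conv cs (shift j f) ≗ shift j (conv cs f)
  conv-shift []       j f n = sym (shift-0 j n)
  conv-shift (c ∷ cs) j f n = begin
    conv (c ∷ cs) (shift j f) n
      ≡⟨ conv-∷ c cs (shift j f) n ⟩
    c * shift j f n + shift 1 (conv cs (shift j f)) n
      ≡⟨ cong₂ _+_ (sym (shift-* j c f n))
           (trans (shift-cong 1 (conv-shift cs j f) n) (shift-comm 1 j (conv cs f) n)) ⟩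
    shift j (λ n → c * f n) n + shift j (shift 1 (conv cs f)) n
      ≡⟨ shift-⊞ j (λ n → c * f n) (shift 1 (conv cs f)) n ⟨
    shift j ((λ n → c * f n) ⊞ shift 1 (conv cs f)) n
      ≡⟨ shift-cong j (conv-∷ c cs f) n ⟨
    shift j (conv (c ∷ cs) f) n ∎
    where open ≡-Reasoning

  infixl 6 _+ₚ_
  _+ₚ_ : Poly → Poly → Poly
  []       +ₚ ds       = ds
  (c ∷ cs) +ₚ []       = c ∷ cs
  (c ∷ cs) +ₚ (d ∷ ds) = (c + d) ∷ (cs +ₚ ds)

  infixr 7 _·ₚ_
  _·ₚ_ : ℤ → Poly → Poly
  a ·ₚ []       = []
  a ·ₚ (c ∷ cs) = a * c ∷ a ·ₚ cs

  infixr 7 x^_·_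
  x^_·_ : ℕ → Poly → Poly
  x^ j · cs = replicate j 0ℤ ++ cs

  conv-+ₚ : ∀ cs ds f → conv (cs +ₚ ds) f ≗ conv cs f ⊞ conv ds f
  conv-+ₚ []       ds       f n = sym (ℤ.+-identityˡ _)
  conv-+ₚ (c ∷ cs) []       f n = sym (ℤ.+-identityʳ _)
  conv-+ₚ (c ∷ cs) (d ∷ ds) f n = begin
    conv ((c + d) ∷ (cs +ₚ ds)) f n
      ≡⟨ conv-∷ (c + d) (cs +ₚ ds) f n ⟩
    (c + d) * f n + shift 1 (conv (cs +ₚ ds) f) n
      ≡⟨ cong₂ _+_ (ℤ.*-distribʳ-+ (f n) c d)
           (trans (shift-cong 1 (conv-+ₚ cs ds f) n) (shift-⊞ 1 (conv cs f) (conv ds f) n)) ⟩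
    (c * f n + d * f n) + (shift 1 (conv cs f) n + shift 1 (conv ds f) n)
      ≡⟨ interchange (c * f n) (d * f n) (shift 1 (conv cs f) n) (shift 1 (conv ds f) n) ⟩
    (c * f n + shift 1 (conv cs f) n) + (d * f n + shift 1 (conv ds f) n)
      ≡⟨ cong₂ _+_ (conv-∷ c cs f n) (conv-∷ d ds f n) ⟨
    conv (c ∷ cs) f n + conv (d ∷ ds) f n ∎
    where open ≡-Reasoning

  conv-·ₚ : ∀ a cs f n → conv (a ·ₚ cs) f n ≡ a * conv cs f n
  conv-·ₚ a []       f n = sym (ℤ.*-zeroʳ a)
  conv-·ₚ a (c ∷ cs) f n = begin
    conv (a * c ∷ a ·ₚ cs) f n
      ≡⟨ conv-∷ (a * c) (a ·ₚ cs) f n ⟩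
    a * c * f n + shift 1 (conv (a ·ₚ cs) f) n
      ≡⟨ cong₂ _+_ (ℤ.*-assoc a c (f n))
           (trans (shift-cong 1 (conv-·ₚ a cs f) n) (shift-* 1 a (conv cs f) n)) ⟩
    a * (c * f n) + a * shift 1 (conv cs f) n
      ≡⟨ ℤ.*-distribˡ-+ a (c * f n) (shift 1 (conv cs f) n) ⟨
    a * (c * f n + shift 1 (conv cs f) n)
      ≡⟨ cong (a *_) (conv-∷ c cs f n) ⟨
    a * conv (c ∷ cs) f n ∎
    where open ≡-Reasoning

  conv-x^ : ∀ j cs f → conv (x^ j · cs) f ≗ shift j (conv cs f)
  conv-x^ zero    cs f n = refl
  conv-x^ (suc j) cs f n = begin
    conv (x^ suc j · cs) f n
      ≡⟨ conv-∷ 0ℤ (x^ j · cs) f n ⟩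
    0ℤ + shift 1 (conv (x^ j · cs) f) n
      ≡⟨ ℤ.+-identityˡ _ ⟩
    shift 1 (conv (x^ j · cs) f) n
      ≡⟨ shift-cong 1 (conv-x^ j cs f) n ⟩
    shift 1 (shift j (conv cs f)) n
      ≡⟨ shift-shift 1 j (conv cs f) n ⟩
    shift (suc j) (conv cs f) n ∎
    where open ≡-Reasoning

  conv-1 : ∀ f → conv (1ℤ ∷ []) f ≗ f
  conv-1 f n = trans (ℤ.+-identityʳ _) (ℤ.*-identityˡ (f n))

  conv-x^+ₚ : ∀ cs j ds f n → conv (cs +ₚ x^ j · ds) f n ≡ conv cs f n + shift j (conv ds f) n
  conv-x^+ₚ cs j ds f n = trans (conv-+ₚ cs (x^ j · ds) f n) (cong (λ z → conv cs f n + z) (conv-x^ j ds f n))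

  -- Multiplication by a polynomial commutes with division by 1 - x^(1 + k), so the series
  -- `conv cs (p k)` form a tower just as the `p k` do.
  conv-quotient : ∀ cs {k f g} → Quotient k f g → Quotient k (conv cs f) (conv cs g)
  conv-quotient cs {k} {f} {g} q n =
    trans (conv-cong cs q n)
    (trans (conv-⊞ cs f (shift (suc k) g) n)
           (cong (λ z → conv cs f n + z) (conv-shift cs (suc k) g n)))

  δ : Seq
  δ zero    = 1ℤ
  δ (suc _) = 0ℤ

  conv-δ-≥ : ∀ cs {n} → length cs ℕ.≤ n → conv cs δ n ≡ 0ℤ
  conv-δ-≥ []       _ = refl
  conv-δ-≥ (c ∷ cs) {suc n} (s≤s len) = begin
    conv (c ∷ cs) δ (suc n)   ≡⟨ conv-∷ c cs δ (suc n) ⟩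
    c * 0ℤ + conv cs δ n      ≡⟨ cong₂ _+_ (ℤ.*-zeroʳ c) (conv-δ-≥ cs len) ⟩
    0ℤ                        ∎
    where open ≡-Reasoning

  -- Positivity along a tower of quotients.

  Tower : (ℕ → Seq) → Set
  Tower D = ∀ k → Quotient k (D k) (D (suc k))

  -- Writing an index as j + n instead of subtracting j lets `shift-+` apply directly.
  data Position (j : ℕ) : ℕ → Set where
    before : ∀ {n} → n ℕ.< j → Position j n
    after  : ∀ n → Position j (j ℕ.+ n)

  position : ∀ j n → Position j n
  position zero    n       = after n
  position (suc j) zero    = before (s≤s z≤n)
  position (suc j) (suc n) with position j n
  ... | before n<j = before (s≤s n<j)
  ... | after n′   = after n′

  quotient-before : ∀ {k n} f g → Quotient k f g → n ℕ.≤ k → g n ≡ f n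
  quotient-before {k} {n} f g q n≤k =
    trans (q n) (trans (cong (λ z → f n + z) (shift-< g (s≤s n≤k))) (ℤ.+-identityʳ _))

  quotient-after : ∀ {k} f g n → Quotient k f g → g (suc k ℕ.+ n) ≡ f (suc k ℕ.+ n) + g n
  quotient-after {k} f g n q = trans (q (suc k ℕ.+ n)) (cong (λ z → f (suc k ℕ.+ n) + z) (shift-+ (suc k) g n))

  -- Where f is nonnegative, g does not decrease in steps of 1 + k. Every index from M on therefore
  -- descends by such steps to the window of 1 + k indices starting at M, where the bound is given.
  quotient-≥ : ∀ {k f g M L} → Quotient k f g → (∀ n → M ℕ.≤ n → 0ℤ ≤ f n) →
               (∀ n → M ℕ.≤ n → n ℕ.< suc k ℕ.+ M → L ≤ g n) → ∀ n → M ℕ.≤ n → L ≤ g n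
  quotient-≥ {k} {f} {g} {M} {L} q f≥0 window = <-rec _ go
    where
    go : ∀ n → (∀ {m} → m ℕ.< n → M ℕ.≤ m → L ≤ g m) → M ℕ.≤ n → L ≤ g n
    go n rec M≤n with n ℕ.<? suc k ℕ.+ M
    ... | yes n<   = window n M≤n n<
    ... | no  n≮ with position (suc k) n
    ...   | before n<j = contradiction (ℕ.≤-trans n<j (ℕ.m≤m+n (suc k) M)) n≮
    ...   | after m    = subst (L ≤_) (sym (quotient-after f g m q))
                           (subst (_≤ f (suc k ℕ.+ m) + g m) (ℤ.+-identityˡ L)
                             (ℤ.+-mono-≤ (f≥0 _ M≤n)
                               (rec (s≤s (ℕ.m≤n+m m k)) (ℕ.+-cancelˡ-≤ (suc k) M m (ℕ.≮⇒≥ n≮)))))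

  -- The negative values of the tower below M cost at most C each, and at most M of them are ever
  -- used on the way from level K up, which the reserve at level K pays for.
  tower-positive :
    ∀ (D : ℕ → Seq) M K C .{{_ : ℕ.NonZero K}} → Tower D →
    (∀ n → M ℕ.≤ n → 0ℤ ≤ D 0 n) →
    (∀ k n → k ℕ.< K → M ℕ.≤ n → n ℕ.< K ℕ.+ M → 0ℤ ≤ D k n) →
    (∀ n → M ℕ.≤ n → n ℕ.< K ℕ.+ M → + suc (M ℕ.* C) ≤ D K n) →
    (∀ k n → k ℕ.≤ M → n ℕ.< M → - (+ C) ≤ D k n) →
    ∀ k n → K ℕ.≤ k → M ℕ.≤ n → 1ℤ ≤ D k n
  tower-positive D M K@(suc K₀) C tower base window reserve floor k n K≤k M≤n =
    subst (λ j → 1ℤ ≤ D j n) (ℕ.m∸n+n≡m K≤k)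
      (ℤ.≤-trans (+≤+ (s≤s z≤n)) (high (k ℕ.∸ K) n M≤n))
    where
    low : ∀ k → k ℕ.< K → ∀ n → M ℕ.≤ n → 0ℤ ≤ D k n
    low zero    _   = base
    low (suc k) k<K = quotient-≥ (tower k) (low k (ℕ.<-trans ℕ.≤-refl k<K))
      (λ n M≤n n< → window (suc k) n k<K M≤n (ℕ.<-≤-trans n< (ℕ.+-monoˡ-≤ M (ℕ.<⇒≤ k<K))))

    -- Passing from level k to level 1 + k changes no entry with index at most k. Past level M the
    -- entries below M are thus frozen, and the floor checked up to level M holds at every level.
    floor′ : ∀ k n → n ℕ.< M → - (+ C) ≤ D k n
    floor′ zero    n n<M = floor zero n z≤n n<M
    floor′ (suc k) n n<M with suc k ℕ.≤? M
    ... | yes k<M = floor (suc k) n k<M n<M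
    ... | no  k≮M = subst (- (+ C) ≤_)
      (sym (quotient-before (D k) (D (suc k)) (tower k) (ℕ.≤-trans (ℕ.<⇒≤ n<M) (ℕ.≮⇒≥ k≮M)))) (floor′ k n n<M)

    -- At level k the recurrence adds the entry at n - k. This index drops by one from level to
    -- level, so it is below M at most `M ⊓ (n ∸ k)` more times after level k, and each time costs
    -- at most C. When it is at least M, the added entry is nonnegative by induction on n.
    high : ∀ j n → M ℕ.≤ n → + suc ((M ℕ.⊓ (n ℕ.∸ (j ℕ.+ K))) ℕ.* C) ≤ D (j ℕ.+ K) n
    high zero n M≤n =
      ℤ.≤-trans (+≤+ (s≤s (ℕ.*-monoˡ-≤ C (ℕ.m⊓n≤m M (n ℕ.∸ K))))) (quotient-≥ (tower K₀) (low K₀ ℕ.≤-refl) reserve n M≤n)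
    high (suc j) = <-rec _ go
      where
      k′ = j ℕ.+ K
      excess : ∀ m → suc k′ ℕ.+ m ℕ.∸ k′ ≡ suc m
      excess m = trans (cong (ℕ._∸ k′) (sym (ℕ.+-suc k′ m))) (ℕ.m+n∸m≡n k′ (suc m))
      m≤excess : ∀ m → m ℕ.≤ suc k′ ℕ.+ m ℕ.∸ k′
      m≤excess m = subst (m ℕ.≤_) (sym (excess m)) (ℕ.n≤1+n m)
      cancel : ∀ {m} → m ℕ.< M → + suc ((M ℕ.⊓ (suc k′ ℕ.+ m ℕ.∸ k′)) ℕ.* C) + - (+ C) ≡ + suc ((M ℕ.⊓ m) ℕ.* C)
      cancel {m} m<M = begin
        + suc ((M ℕ.⊓ (suc k′ ℕ.+ m ℕ.∸ k′)) ℕ.* C) + - (+ C)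
          ≡⟨ cong (λ z → + suc ((M ℕ.⊓ z) ℕ.* C) + - (+ C)) (excess m) ⟩
        + suc ((M ℕ.⊓ suc m) ℕ.* C) + - (+ C)
          ≡⟨ cong (λ z → + suc (z ℕ.* C) + - (+ C)) (ℕ.m≥n⇒m⊓n≡n m<M) ⟩
        + suc (C ℕ.+ m ℕ.* C) + - (+ C)
          ≡⟨ cong (λ z → + z + - (+ C)) (ℕ.+-suc C (m ℕ.* C)) ⟨
        + C + + suc (m ℕ.* C) + - (+ C)
          ≡⟨ cong (_+ - (+ C)) (ℤ.+-comm (+ C) (+ suc (m ℕ.* C))) ⟩
        + suc (m ℕ.* C) + + C + - (+ C)
          ≡⟨ ℤ.+-assoc (+ suc (m ℕ.* C)) (+ C) (- (+ C)) ⟩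
        + suc (m ℕ.* C) + (+ C + - (+ C))
          ≡⟨ cong (λ z → + suc (m ℕ.* C) + z) (ℤ.+-inverseʳ (+ C)) ⟩
        + suc (m ℕ.* C) + 0ℤ
          ≡⟨ ℤ.+-identityʳ _ ⟩
        + suc (m ℕ.* C)
          ≡⟨ cong (λ z → + suc (z ℕ.* C)) (ℕ.m≥n⇒m⊓n≡n (ℕ.<⇒≤ m<M)) ⟨
        + suc ((M ℕ.⊓ m) ℕ.* C) ∎
        where open ≡-Reasoning
      go : ∀ n → (∀ {m} → m ℕ.< n → M ℕ.≤ m → + suc ((M ℕ.⊓ (m ℕ.∸ suc k′)) ℕ.* C) ≤ D (suc k′) m) →
           M ℕ.≤ n → + suc ((M ℕ.⊓ (n ℕ.∸ suc k′)) ℕ.* C) ≤ D (suc k′) n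
      go n rec M≤n with position (suc k′) n
      ... | before (s≤s n≤k) = subst (_ ≤_) (sym (quotient-before (D k′) (D (suc k′)) (tower k′) n≤k))
            (subst (λ z → + suc ((M ℕ.⊓ z) ℕ.* C) ≤ D k′ n)
              (trans (ℕ.m≤n⇒m∸n≡0 n≤k) (sym (ℕ.m≤n⇒m∸n≡0 (ℕ.m≤n⇒m≤1+n n≤k)))) (high j n M≤n))
      ... | after m
        rewrite quotient-after (D k′) (D (suc k′)) m (tower k′) | ℕ.m+n∸m≡n (suc k′) m
        with M ℕ.≤? m
      ...   | yes M≤m = subst (_≤ D k′ (suc k′ ℕ.+ m) + D (suc k′) m) (ℤ.+-identityʳ _)
                (ℤ.+-mono-≤
                  (ℤ.≤-trans (+≤+ (s≤s (ℕ.*-monoˡ-≤ C (ℕ.⊓-monoʳ-≤ M (m≤excess m))))) (high j (suc k′ ℕ.+ m) M≤n))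
                  (ℤ.≤-trans (+≤+ z≤n) (rec (s≤s (ℕ.m≤n+m m k′)) M≤m)))
      ...   | no  M≰m = subst (_≤ D k′ (suc k′ ℕ.+ m) + D (suc k′) m) (cancel (ℕ.≰⇒> M≰m))
                (ℤ.+-mono-≤ (high j (suc k′ ℕ.+ m) M≤n) (floor′ (suc k′) m (ℕ.≰⇒> M≰m)))

  quotient-unique : ∀ k f {g h} → Quotient k f g → Quotient k f h → g ≗ h
  quotient-unique k f {g} {h} qg qh = <-rec _ go
    where
    go : ∀ n → (∀ {m} → m ℕ.< n → g m ≡ h m) → g n ≡ h n
    go n rec with position (suc k) n
    ... | before (s≤s n≤k) = trans (quotient-before f g qg n≤k) (sym (quotient-before f h qh n≤k))
    ... | after m = trans (quotient-after f g m qg)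
                   (trans (cong (λ z → f (suc k ℕ.+ m) + z) (rec (s≤s (ℕ.m≤n+m m k))))
                          (sym (quotient-after f h m qh)))

  quotient-resp : ∀ k {f f′ g} → f ≗ f′ → Quotient k f g → Quotient k f′ g
  quotient-resp k {g = g} e q n = trans (q n) (cong (_+ shift (suc k) g n) (e n))

  -- 1 / ((1 - x)(1 - x²)⋯(1 - x^k)), whose n-th coefficient counts the partitions of n into parts at most k
  p : ℕ → Seq
  p zero    = δ
  p (suc k) = geo k (p k)

  p-tower : Tower p
  p-tower k = geo-quotient k (p k)

  -- Certificates: positivity decided by a finite table.

  T-both : ∀ {a b} → T (a ∧ b) → T a × T b
  T-both = Equivalence.to T-∧

  leading≥ : ℕ → ℤ → List ℤ → Bool
  leading≥ zero    L xs       = true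
  leading≥ (suc t) L []       = true
  leading≥ (suc t) L (x ∷ xs) = (L ≤ᵇ x) ∧ leading≥ t L xs

  leading≥-desc : ∀ t L f N → T (leading≥ t L (desc f N)) →
                  ∀ n → n ℕ.< N → N ℕ.≤ t ℕ.+ n → L ≤ f n
  leading≥-desc zero    L f N       _  n n<N N≤n = contradiction n<N (ℕ.≤⇒≯ N≤n)
  leading≥-desc (suc t) L f (suc N) ok n (s≤s n≤N) (s≤s N≤) with T-both {L ≤ᵇ f N} ok | ℕ.m≤n⇒m<n∨m≡n n≤N
  ... | L≤x , _    | inj₂ refl = ℤ.≤ᵇ⇒≤ L≤x
  ... | _   , rest | inj₁ n<N  = leading≥-desc t L f N rest n n<N N≤

  scan : (ℕ → List ℤ → Bool) → ℕ → ℕ → List ℤ → Bool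
  scan test zero    k row = test k row
  scan test (suc j) k row = test k row ∧ scan test j (suc k) (geoStep k row)

  -- Each row is obtained by `geoStep` from the preceding one, and `geoStep-desc` identifies it with
  -- the coefficients of the next level. One evaluation of `scan` thus settles the test at all
  -- levels in its range.
  scan-desc : ∀ test D N → Tower D → ∀ j k → T (scan test j k (desc (D k) N)) →
              ∀ i → i ℕ.≤ j → T (test (i ℕ.+ k) (desc (D (i ℕ.+ k)) N))
  scan-desc test D N tower zero    k ok zero    _ = ok
  scan-desc test D N tower (suc j) k ok zero    _ = proj₁ (T-both {test k (desc (D k) N)} ok)
  scan-desc test D N tower (suc j) k ok (suc i) (s≤s i≤j) =
    subst (λ l → T (test l (desc (D l) N))) (ℕ.+-suc i k)
      (scan-desc test D N tower j (suc k)
        (subst (λ row → T (scan test j (suc k) row)) (geoStep-desc k (tower k) N)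
          (proj₂ (T-both {test k (desc (D k) N)} ok))) i i≤j)

  -- Positivity is certified from index M and level K = 1 + K₀ on; -C is the floor for the tabulated
  -- entries.
  module Certificate (M K₀ C : ℕ) where

    private
      K = suc K₀
      bound : ℕ → ℤ
      bound k = if k <ᵇ K then 0ℤ else + suc (M ℕ.* C)

    -- Rows are reversed, so the K leading entries are those at M, …, K + M - 1.
    rowOK : ℕ → List ℤ → Bool
    rowOK k row = leading≥ K (bound k) row ∧ leading≥ (K ℕ.+ M) (- (+ C)) row

    -- The first conjunct makes level 0 vanish from index M on. The second places the reserve level
    -- K among the scanned levels 0, ..., M.
    check : Poly → Bool
    check cs = (length cs ℕ.≤ᵇ M) ∧ (K ℕ.≤ᵇ M) ∧ scan rowOK M 0 (desc (conv cs δ) (K ℕ.+ M))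

    certified-positive : ∀ cs → T (check cs) → ∀ k n → K ℕ.≤ k → M ℕ.≤ n → 1ℤ ≤ conv cs (p k) n
    certified-positive cs ok with T-both {length cs ℕ.≤ᵇ M} ok
    ... | len , ok′ with T-both {K ℕ.≤ᵇ M} ok′
    ... | K≤M′ , scanned = tower-positive D M K C tower base window reserve floor
      where
      D : ℕ → Seq
      D k = conv cs (p k)
      tower : Tower D
      tower k = conv-quotient cs {k} {p k} {p (suc k)} (p-tower k)
      K≤M = ℕ.≤ᵇ⇒≤ K M K≤M′
      rows : ∀ k → k ℕ.≤ M → T (rowOK k (desc (D k) (K ℕ.+ M)))
      rows k k≤M = subst (λ k → T (rowOK k (desc (D k) (K ℕ.+ M)))) (ℕ.+-identityʳ k)
        (scan-desc rowOK D (K ℕ.+ M) tower M 0 scanned k k≤M)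
      base : ∀ n → M ℕ.≤ n → 0ℤ ≤ D 0 n
      base n M≤n = ℤ.≤-reflexive (sym (conv-δ-≥ cs (ℕ.≤-trans (ℕ.≤ᵇ⇒≤ _ M len) M≤n)))
      windows : ∀ k n → k ℕ.≤ M → M ℕ.≤ n → n ℕ.< K ℕ.+ M → bound k ≤ D k n
      windows k n k≤M M≤n n< = leading≥-desc K (bound k) (D k) (K ℕ.+ M)
        (proj₁ (T-both {leading≥ K (bound k) (desc (D k) (K ℕ.+ M))} (rows k k≤M))) n n< (ℕ.+-monoʳ-≤ K M≤n)
      window : ∀ k n → k ℕ.< K → M ℕ.≤ n → n ℕ.< K ℕ.+ M → 0ℤ ≤ D k n
      window k n k<K M≤n n< with k <ᵇ K | ℕ.<⇒<ᵇ k<K | windows k n (ℕ.≤-trans (ℕ.<⇒≤ k<K) K≤M) M≤n n<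
      ... | true | _ | w = w
      reserve : ∀ n → M ℕ.≤ n → n ℕ.< K ℕ.+ M → + suc (M ℕ.* C) ≤ D K n
      reserve n M≤n n< with K <ᵇ K | (λ t → ℕ.<-irrefl refl (ℕ.<ᵇ⇒< K K t)) | windows K n K≤M M≤n n<
      ... | false | _  | w = w
      ... | true  | ¬t | w = contradiction tt ¬t
      floor : ∀ k n → k ℕ.≤ M → n ℕ.< M → - (+ C) ≤ D k n
      floor k n k≤M n<M = leading≥-desc (K ℕ.+ M) (- (+ C)) (D k) (K ℕ.+ M)
        (proj₂ (T-both {leading≥ K (bound k) (desc (D k) (K ℕ.+ M))} (rows k k≤M)))
        n (ℕ.<-≤-trans n<M (ℕ.m≤n+m M K)) (ℕ.m≤m+n (K ℕ.+ M) n)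

-- Generating functions and enumerations of partitions.

module Counting where

  open PowerSeries
  open import Data.Nat as ℕ using (zero; suc; z≤n; s≤s)
  import Data.Nat.Properties as ℕ
  open import Data.Nat.ListAction using (sum)
  open import Data.Integer using (ℤ; +_; -_; 0ℤ; 1ℤ; _+_; _*_)
  import Data.Integer.Properties as ℤ
  open import Data.List using (List; []; _∷_; length; _++_; map)
  open import Data.List.Properties using (length-++; length-map)
  open import Data.List.Relation.Unary.All as All using (All; []; _∷_)
  open import Data.List.Relation.Unary.AllPairs using (AllPairs; []; _∷_)
  open import Data.List.Relation.Unary.Any using (here)
  open import Data.List.Membership.Propositional using (_∈_)
  open import Data.List.Membership.Propositional.Properties using (∈-++⁺ˡ; ∈-++⁺ʳ; ∈-map⁺)
  open import Data.Product using (_×_; _,_)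
  open import Data.Sum using (_⊎_; inj₁; inj₂)
  open import Relation.Nullary using (yes; no; contradiction)
  open import Relation.Binary.PropositionalEquality

  -- Q i = (1 - x²)(1 - x⁴)⋯(1 - x^(2i))
  Q : ℕ → Poly
  Q zero    = 1ℤ ∷ []
  Q (suc i) = Q i +ₚ - 1ℤ ·ₚ x^ (suc i ℕ.+ suc i) · Q i

  -- v i m n is the number of partitions of n into parts at most m, those at most i being distinct.
  v : ℕ → ℕ → Seq
  v i zero = δ
  v i (suc m) with suc m ℕ.≤? i
  ... | yes _ = v i m ⊞ shift (suc m) (v i m)
  ... | no  _ = geo m (v i m)

  conv-Q-suc : ∀ i f → conv (Q (suc i)) f ≗ λ n → conv (Q i) f n + - 1ℤ * shift (suc i ℕ.+ suc i) (conv (Q i) f) n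
  conv-Q-suc i f n =
    trans (conv-+ₚ (Q i) (- 1ℤ ·ₚ x^ (suc i ℕ.+ suc i) · Q i) f n)
      (cong (λ z → conv (Q i) f n + z)
        (trans (conv-·ₚ (- 1ℤ) (x^ (suc i ℕ.+ suc i) · Q i) f n)
               (cong (λ z → - 1ℤ * z) (conv-x^ (suc i ℕ.+ suc i) (Q i) f n))))

  -- (1 - x^(2j)) / (1 - x^j) = 1 + x^j
  quotient-twice : ∀ k f g → Quotient k f g → ∀ n →
    g n + - 1ℤ * shift (suc k ℕ.+ suc k) g n ≡ f n + shift (suc k) f n
  quotient-twice k f g q n = begin
    g n + - 1ℤ * shift (j ℕ.+ j) g n
      ≡⟨ cong₂ _+_ (trans (q n) (cong (λ z → f n + z) shifted))
                   (cong (λ z → - 1ℤ * z) (sym (shift-shift j j g n))) ⟩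
    f n + (shift j f n + y) + - 1ℤ * y
      ≡⟨ cong₂ _+_ (sym (ℤ.+-assoc (f n) (shift j f n) y)) (ℤ.-1*i≡-i y) ⟩
    f n + shift j f n + y + - y
      ≡⟨ ℤ.+-assoc (f n + shift j f n) y (- y) ⟩
    f n + shift j f n + (y + - y)
      ≡⟨ cong (λ z → f n + shift j f n + z) (ℤ.+-inverseʳ y) ⟩
    f n + shift j f n + 0ℤ
      ≡⟨ ℤ.+-identityʳ _ ⟩
    f n + shift j f n ∎
    where
    open ≡-Reasoning
    j = suc k
    y = shift j (shift j g) n
    shifted : shift j g n ≡ shift j f n + y
    shifted = trans (shift-cong j q n) (shift-⊞ j f (shift j g) n)

  -- Up to level i all parts are distinct, and each factor 1 + x^j equals (1 - x^(2j)) / (1 - x^j).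
  v-small : ∀ i m → m ℕ.≤ i → v i m ≗ conv (Q m) (p m)
  v-small i zero    _   n = sym (conv-1 δ n)
  v-small i (suc m) m<i n with suc m ℕ.≤? i
  ... | no  m≮i = contradiction m<i m≮i
  ... | yes _   = trans
    (cong₂ _+_ (v-small i m (ℕ.<⇒≤ m<i) n) (shift-cong (suc m) (v-small i m (ℕ.<⇒≤ m<i)) n))
    (trans (sym (quotient-twice m (conv (Q m) (p m)) (conv (Q m) (p (suc m)))
                  (conv-quotient (Q m) {m} {p m} {p (suc m)} (p-tower m)) n))
           (sym (conv-Q-suc m (p (suc m)) n)))

  -- From level i on both sides are divided by the same factors, and quotients are unique; `v-small`
  -- supplies the start.
  v-conv : ∀ i j → v i (j ℕ.+ i) ≗ conv (Q i) (p (j ℕ.+ i))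
  v-conv i zero = v-small i i ℕ.≤-refl
  v-conv i (suc j) with suc (j ℕ.+ i) ℕ.≤? i
  ... | yes j<i = contradiction j<i (ℕ.<⇒≱ (s≤s (ℕ.m≤n+m i j)))
  ... | no  _   = quotient-unique m (conv (Q i) (p m))
      (quotient-resp m (v-conv i j) (geo-quotient m (v i m)))
      (conv-quotient (Q i) {m} {p m} {p (suc m)} (p-tower m))
    where m = j ℕ.+ i

  -- Lists the partitions counted by v i m n; the first argument bounds the number of parts.
  enum : (k i m n : ℕ) → List (List ℕ)
  enum k       i m       zero    = [] ∷ []
  enum zero    i m       (suc n) = []
  enum (suc k) i zero    (suc n) = []
  enum (suc k) i (suc m) (suc n) with m ℕ.≤? n | suc m ℕ.≤? i
  ... | no  _ | _     = enum (suc k) i m (suc n)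
  ... | yes _ | yes _ = enum (suc k) i m (suc n) ++ map (suc m ∷_) (enum k i m       (n ℕ.∸ m))
  ... | yes _ | no  _ = enum (suc k) i m (suc n) ++ map (suc m ∷_) (enum k i (suc m) (n ℕ.∸ m))

  shift-∸ : ∀ {j n} f → j ℕ.≤ n → shift j f n ≡ f (n ℕ.∸ j)
  shift-∸ {zero}  f _         = refl
  shift-∸ {suc j} f (s≤s j≤n) = shift-∸ f j≤n

  +length-++-map : ∀ {A : Set} (g : A → A) xs ys →
    + length (xs ++ map g ys) ≡ + length xs + + length ys
  +length-++-map g xs ys = cong +_ (trans (length-++ xs) (cong (length xs ℕ.+_) (length-map g ys)))

  v-zero : ∀ i m → v i m zero ≡ 1ℤ
  v-zero i zero = refl
  v-zero i (suc m) with suc m ℕ.≤? i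
  ... | yes _ = trans (ℤ.+-identityʳ _) (v-zero i m)
  ... | no  _ = trans (quotient-before (v i m) (geo m (v i m)) (geo-quotient m (v i m)) z≤n) (v-zero i m)

  v-suc : ∀ {i m} → suc m ℕ.≰ i → v i (suc m) ≡ geo m (v i m)
  v-suc {i} {m} m≮i with suc m ℕ.≤? i
  ... | yes m<i = contradiction m<i m≮i
  ... | no  _   = refl

  -- Parts are positive, so for n ≤ k the bound on their number excludes nothing. Splitting by
  -- whether the part 1 + m occurs then yields the recurrence of `v`.
  length-enum : ∀ k i m n → n ℕ.≤ k → + length (enum k i m n) ≡ v i m n
  length-enum k       i m       zero    _ = sym (v-zero i m)
  length-enum (suc k) i zero    (suc n) _ = refl
  length-enum (suc k) i (suc m) (suc n) n≤k with m ℕ.≤? n | suc m ℕ.≤? i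
  ... | no  m≰n | yes _ = trans (length-enum (suc k) i m (suc n) n≤k)
        (sym (trans (cong (λ z → v i m (suc n) + z) (shift-< (v i m) (s≤s (ℕ.≰⇒> m≰n)))) (ℤ.+-identityʳ _)))
  ... | no  m≰n | no  _ = trans (length-enum (suc k) i m (suc n) n≤k)
        (sym (quotient-before (v i m) (geo m (v i m)) (geo-quotient m (v i m)) (ℕ.≰⇒> m≰n)))
  ... | yes m≤n | yes _ = trans (+length-++-map (suc m ∷_) (enum (suc k) i m (suc n)) _)
        (cong₂ _+_ (length-enum (suc k) i m (suc n) n≤k)
          (trans (length-enum k i m (n ℕ.∸ m) (ℕ.≤-trans (ℕ.m∸n≤m n m) (ℕ.≤-pred n≤k)))
                 (sym (shift-∸ (v i m) (s≤s m≤n)))))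
  ... | yes m≤n | no  m≮i = trans (+length-++-map (suc m ∷_) (enum (suc k) i m (suc n)) _)
        (trans (cong₂ _+_ (length-enum (suc k) i m (suc n) n≤k)
          (trans (length-enum k i (suc m) (n ℕ.∸ m) (ℕ.≤-trans (ℕ.m∸n≤m n m) (ℕ.≤-pred n≤k)))
            (trans (cong (λ f → f (n ℕ.∸ m)) (v-suc m≮i))
                   (sym (shift-∸ (geo m (v i m)) (s≤s m≤n))))))
          (sym (geo-quotient m (v i m) (suc n))))

  length-boxed : ∀ k m n → n ℕ.≤ k → + length (boxed k m n) ≡ p m n
  length-boxed k       m       zero    _  = trans (one k m) (sym (p-zero m))
    where
    one : ∀ k m → + length (boxed k m zero) ≡ 1ℤ
    one zero    m = refl
    one (suc k) m = refl
    p-zero : ∀ m → p m zero ≡ 1ℤ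
    p-zero zero    = refl
    p-zero (suc m) = trans (quotient-before (p m) (p (suc m)) (p-tower m) z≤n) (p-zero m)
  length-boxed (suc k) zero    (suc n) _ = refl
  length-boxed (suc k) (suc m) (suc n) n≤k with m ℕ.≤? n
  ... | no  m≰n = trans (length-boxed (suc k) m (suc n) n≤k)
        (sym (quotient-before (p m) (p (suc m)) (p-tower m) (ℕ.≰⇒> m≰n)))
  ... | yes m≤n = trans (+length-++-map (suc m ∷_) (boxed (suc k) m (suc n)) _)
        (trans (cong₂ _+_ (length-boxed (suc k) m (suc n) n≤k)
          (trans (length-boxed k (suc m) (n ℕ.∸ m) (ℕ.≤-trans (ℕ.m∸n≤m n m) (ℕ.≤-pred n≤k)))
                 (sym (shift-∸ (p (suc m)) (s≤s m≤n)))))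
          (sym (p-tower m (suc n))))

  p-stable : ∀ n j → p (j ℕ.+ n) n ≡ p n n
  p-stable n zero    = refl
  p-stable n (suc j) = trans
    (quotient-before (p (j ℕ.+ n)) (p (suc j ℕ.+ n)) (p-tower (j ℕ.+ n)) (ℕ.m≤n+m n j)) (p-stable n j)

  -- A common K turns the partition numbers of several n into coefficients of one series, to which a
  -- single polynomial can be applied.
  length-partitions : ∀ {n K} → n ℕ.≤ K → + length (partitions n) ≡ p K n
  length-partitions {n} {K} n≤K = trans (length-boxed n n n ℕ.≤-refl)
    (trans (sym (p-stable n (K ℕ.∸ n))) (cong (λ k → p k n) (ℕ.m∸n+n≡m n≤K)))

  -- Relates a part a to a later part b: the order is non-increasing, and a repeated part must
  -- exceed i.
  DistinctUpTo : ℕ → ℕ → ℕ → Set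
  DistinctUpTo i a b = b ℕ.< a ⊎ (b ℕ.≤ a × i ℕ.< a)

  DistinctUpTo⇒≤ : ∀ {i a b} → DistinctUpTo i a b → b ℕ.≤ a
  DistinctUpTo⇒≤ (inj₁ b<a)       = ℕ.<⇒≤ b<a
  DistinctUpTo⇒≤ (inj₂ (b≤a , _)) = b≤a

  -- With `length-enum` this bounds the number of such lists from above by a coefficient of `v`.
  -- Each case follows the branch of `enum` chosen by whether the largest part equals the current
  -- bound.
  enum-complete : ∀ k i m n {xs} → AllPairs (DistinctUpTo i) xs → All (1 ℕ.≤_) xs → sum xs ≡ n →
                  All (ℕ._≤ m) xs → length xs ℕ.≤ k → xs ∈ enum k i m n
  enum-complete k       i m       zero    {[]}           _ _       _  _         _  = here refl
  enum-complete k       i m       zero    {zero ∷ xs}    _ (() ∷ _) _ _         _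
  enum-complete k       i m       zero    {suc x ∷ xs}   _ _       () _         _
  enum-complete _       i m       (suc n) {[]}           _ _       () _         _
  enum-complete (suc k) i zero    (suc n) {x ∷ xs}       _ (x>0 ∷ _) _ (x≤0 ∷ _) _ = contradiction x>0 (ℕ.≤⇒≯ x≤0)
  enum-complete (suc k) i (suc m) (suc n) {x ∷ xs} pairs@(px ∷ pairs′) pos@(_ ∷ pos′) s (x≤m ∷ _) (s≤s len)
    with m ℕ.≤? n | suc m ℕ.≤? i | ℕ.m≤n⇒m<n∨m≡n x≤m
  ... | no  _   | _     | inj₁ (s≤s x≤m′) =
    enum-complete (suc k) i m (suc n) pairs pos s
      (x≤m′ ∷ All.map (λ r → ℕ.≤-trans (DistinctUpTo⇒≤ r) x≤m′) px) (s≤s len)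
  ... | no  m≰n | _     | inj₂ refl =
    contradiction (subst (m ℕ.≤_) (ℕ.suc-injective s) (ℕ.m≤m+n m (sum xs))) m≰n
  ... | yes _   | yes _ | inj₁ (s≤s x≤m′) =
    ∈-++⁺ˡ (enum-complete (suc k) i m (suc n) pairs pos s
      (x≤m′ ∷ All.map (λ r → ℕ.≤-trans (DistinctUpTo⇒≤ r) x≤m′) px) (s≤s len))
  ... | yes _   | no  _ | inj₁ (s≤s x≤m′) =
    ∈-++⁺ˡ (enum-complete (suc k) i m (suc n) pairs pos s
      (x≤m′ ∷ All.map (λ r → ℕ.≤-trans (DistinctUpTo⇒≤ r) x≤m′) px) (s≤s len))
  ... | yes _   | yes m<i | inj₂ refl =
    ∈-++⁺ʳ (enum (suc k) i m (suc n)) (∈-map⁺ (suc m ∷_)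
      (enum-complete k i m (n ℕ.∸ m) pairs′ pos′ rest (All.map below px) len))
    where
    rest : sum xs ≡ n ℕ.∸ m
    rest = trans (sym (ℕ.m+n∸m≡n m (sum xs))) (cong (ℕ._∸ m) (ℕ.suc-injective s))
    below : ∀ {b} → DistinctUpTo i (suc m) b → b ℕ.≤ m
    below (inj₁ b<x)       = ℕ.≤-pred b<x
    below (inj₂ (_ , i<x)) = contradiction m<i (ℕ.<⇒≱ i<x)
  ... | yes _   | no  _ | inj₂ refl =
    ∈-++⁺ʳ (enum (suc k) i m (suc n)) (∈-map⁺ (suc m ∷_)
      (enum-complete k i (suc m) (n ℕ.∸ m) pairs′ pos′ rest (All.map DistinctUpTo⇒≤ px) len))
    where
    rest : sum xs ≡ n ℕ.∸ m
    rest = trans (sym (ℕ.m+n∸m≡n m (sum xs))) (cong (ℕ._∸ m) (ℕ.suc-injective s))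

-- Encoding both kinds of partitions by ordinary ones.

module Encodings where

  open Counting using (DistinctUpTo; DistinctUpTo⇒≤; enum; enum-complete)
  open import Data.Nat using (zero; suc; _+_; _*_; _∸_; _⊓_; _≤_; _>_; z≤n; s≤s; _<?_; ⌊_/2⌋)
  open import Data.Nat.Properties
  open import Data.Nat.Divisibility using (_∣_; m∣m*n; ∣m+n∣m⇒∣n; ∣1⇒≡1)
  open import Data.Nat.ListAction using (sum)
  open import Data.Nat.ListAction.Properties using (sum-++)
  open import Data.Nat.Tactic.RingSolver using (solve-∀)
  open import Data.List using (List; []; _∷_; length; _++_; map; filter; concat; replicate; applyUpTo)
  open import Data.List.Properties
    using (length-++; length-map; ++-assoc; filter-accept; filter-reject; filter-none; ∷-injectiveˡ; ∷-injectiveʳ)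
  open import Data.List.Relation.Unary.All as All using (All; []; _∷_)
  import Data.List.Relation.Unary.All.Properties as All
  open import Data.List.Relation.Unary.AllPairs as AllPairs using (AllPairs; []; _∷_)
  import Data.List.Relation.Unary.AllPairs.Properties as AllPairs
  open import Data.List.Relation.Unary.Any using (here; there)
  open import Data.List.Relation.Unary.Linked.Properties using (Linked⇒AllPairs; AllPairs⇒Linked)
  open import Data.List.Relation.Unary.Unique.Propositional using (Unique)
  import Data.List.Relation.Unary.Unique.Propositional.Properties as Unique
  open import Data.List.Relation.Binary.Disjoint.Propositional using (Disjoint)
  open import Data.List.Relation.Binary.Subset.Propositional using (_⊆_)
  open import Data.List.Membership.Propositional using (_∈_)
  open import Data.List.Membership.Propositional.Properties
    using (∈-++⁺ˡ; ∈-++⁺ʳ; ∈-++⁻; ∈-map⁺; ∈-map⁻; ∈-∃++; ∈-filter⁺; ∈-filter⁻; ∈-concat⁺′; ∈-concat⁻′; ∈-applyUpTo⁺)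
  open import Data.Product using (_×_; _,_; proj₁; proj₂)
  open import Data.Sum using (_⊎_; inj₁; inj₂)
  open import Function using (_∘_; flip)
  open import Relation.Nullary using (yes; no; contradiction)
  open import Relation.Nullary.Decidable using (_×-dec_)
  open import Relation.Unary using (Decidable)
  open import Relation.Binary.PropositionalEquality

  -- Pigeonhole principle: the head occurs somewhere in ys and not in the tail, so it can be cut out
  -- of ys before the induction.
  Unique-⊆⇒length≤ : ∀ {A : Set} {xs ys : List A} → Unique xs → xs ⊆ ys → length xs ≤ length ys
  Unique-⊆⇒length≤ [] _ = z≤n
  Unique-⊆⇒length≤ {xs = x ∷ xs} (x∉xs ∷ u) sub with ∈-∃++ (sub (here refl))
  ... | as , bs , refl = begin
    suc (length xs)             ≤⟨ s≤s (Unique-⊆⇒length≤ u drop-x) ⟩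
    suc (length (as ++ bs))     ≡⟨ cong suc (length-++ as) ⟩
    suc (length as + length bs) ≡⟨ +-suc (length as) (length bs) ⟨
    length as + suc (length bs) ≡⟨ length-++ as ⟨
    length (as ++ x ∷ bs)       ∎
    where
    open ≤-Reasoning
    drop-x : xs ⊆ as ++ bs
    drop-x y∈xs with ∈-++⁻ as (sub (there y∈xs))
    ... | inj₁ y∈as         = ∈-++⁺ˡ y∈as
    ... | inj₂ (here refl)  = contradiction refl (All.lookup x∉xs y∈xs)
    ... | inj₂ (there y∈bs) = ∈-++⁺ʳ as y∈bs

  -- Injectivity is relative to P because `stair r` is injective on lists of positive entries but
  -- confuses zeros with missing entries.
  Unique-map⁺ : ∀ {A B : Set} {P : A → Set} {f : A → B} {xs} →
    (∀ {x y} → P x → P y → f x ≡ f y → x ≡ y) → All P xs → Unique xs → Unique (map f xs)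
  Unique-map⁺ inj []       []       = []
  Unique-map⁺ {f = f} {xs = x ∷ _} inj (p ∷ ps) (q ∷ qs) = All.map⁺ (go ps q) ∷ Unique-map⁺ inj ps qs
    where
    go : ∀ {ys} → All _ ys → All (x ≢_) ys → All (λ y → f x ≢ f y) ys
    go []       []       = []
    go (r ∷ rs) (s ∷ ss) = (s ∘ inj p r) ∷ go rs ss

  -- Lower bound: odd parts above even parts, by adding a staircase.

  even-2* : ∀ b → Even (2 * b)
  even-2* b = m∣m*n b

  odd-suc2* : ∀ b → Odd (suc (2 * b))
  odd-suc2* b e with ∣1⇒≡1 (∣m+n∣m⇒∣n (subst (2 ∣_) (+-comm 1 (2 * b)) e) (even-2* b))
  ... | ()

  suc2*≤2*suc : ∀ b → suc (2 * b) ≤ 2 * suc b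
  suc2*≤2*suc b = subst (suc (2 * b) ≤_) (sym (*-suc 2 b)) (n≤1+n _)

  -- Adds the staircase r-1, ..., 0 to the first r entries, then sends these to 2a + 1 and the
  -- others to 2a. A list with fewer than r entries is padded with zeros. The staircase contributes
  -- 1 + 3 + ⋯ + (2r - 1) = r² to the sum.
  stair : ℕ → List ℕ → List ℕ
  stair zero    xs       = map (2 *_) xs
  stair (suc r) []       = suc (2 * r) ∷ stair r []
  stair (suc r) (a ∷ xs) = suc (2 * (a + r)) ∷ stair r xs

  -- The bound is one less than 2(b + r) + 1, the odd entry that `stair (suc r)` puts in front when
  -- the head is b.
  stair-bound : ∀ r {b xs} → All (_≤ b) xs → All (_≤ 2 * (b + r)) (stair r xs)
  stair-bound zero {b} bs =
    All.map⁺ (All.map (λ x≤b → *-monoʳ-≤ 2 (≤-trans x≤b (m≤m+n b 0))) bs)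
  stair-bound (suc r) {b} {xs} bs rewrite +-suc b r = go bs
    where
    widen : ∀ {ys} → All (_≤ 2 * (b + r)) ys → All (_≤ 2 * suc (b + r)) ys
    widen = All.map (λ y≤ → ≤-trans y≤ (*-monoʳ-≤ 2 (n≤1+n (b + r))))
    go : ∀ {xs} → All (_≤ b) xs → All (_≤ 2 * suc (b + r)) (stair (suc r) xs)
    go []         = ≤-trans (s≤s (*-monoʳ-≤ 2 (m≤n+m r b))) (suc2*≤2*suc (b + r)) ∷ widen (stair-bound r {b} [])
    go (x≤b ∷ bs) = ≤-trans (s≤s (*-monoʳ-≤ 2 (+-monoˡ-≤ r x≤b))) (suc2*≤2*suc (b + r)) ∷ widen (stair-bound r bs)

  -- For x standing before y; as a pairwise condition it captures the order, the separation of
  -- parities and the distinctness of odd parts at once.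
  OddsFirst : ℕ → ℕ → Set
  OddsFirst x y = (Odd x × y < x) ⊎ (Even x × Even y × y ≤ x)

  stair-pairs : ∀ r {xs} → AllPairs _≥_ xs → AllPairs OddsFirst (stair r xs)
  stair-pairs zero xs≥ = AllPairs.map⁺
    (AllPairs.map (λ {x} {y} y≤x → inj₂ (even-2* x , even-2* y , *-monoʳ-≤ 2 y≤x)) xs≥)
  stair-pairs (suc r) []          = All.map (λ y≤ → inj₁ (odd-suc2* r , s≤s y≤)) (stair-bound r {0} []) ∷ stair-pairs r []
  stair-pairs (suc r) {x ∷ _} (x≥ ∷ xs≥) =
    All.map (λ y≤ → inj₁ (odd-suc2* (x + r) , s≤s y≤)) (stair-bound r x≥) ∷ stair-pairs r xs≥

  stair-positive : ∀ r {xs} → All (1 ≤_) xs → All (1 ≤_) (stair r xs)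
  stair-positive zero    ps       = All.map⁺ (All.map (λ {x} p → ≤-trans p (m≤m+n x (x + 0))) ps)
  stair-positive (suc r) []       = s≤s z≤n ∷ stair-positive r []
  stair-positive (suc r) (_ ∷ ps) = s≤s z≤n ∷ stair-positive r ps

  sum-map-2* : ∀ xs → sum (map (2 *_) xs) ≡ 2 * sum xs
  sum-map-2* []       = refl
  sum-map-2* (x ∷ xs) = trans (cong (2 * x +_) (sum-map-2* xs)) (sym (*-distribˡ-+ 2 x (sum xs)))

  sum-stair : ∀ r xs → sum (stair r xs) ≡ r * r + 2 * sum xs
  sum-stair zero    xs       = sum-map-2* xs
  sum-stair (suc r) []       = trans (cong (suc (2 * r) +_) (sum-stair r [])) (eq r)
    where
    eq : ∀ r → suc (2 * r) + (r * r + 0) ≡ suc r * suc r + 0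
    eq = solve-∀
  sum-stair (suc r) (x ∷ xs) = trans (cong (suc (2 * (x + r)) +_) (sum-stair r xs)) (eq r x (sum xs))
    where
    eq : ∀ r x s → suc (2 * (x + r)) + (r * r + 2 * s) ≡ suc r * suc r + 2 * (x + s)
    eq = solve-∀

  -- Recovers r from the image, so images for different r are disjoint.
  odds-stair : ∀ r xs → length (filter odd? (stair r xs)) ≡ r
  odds-stair zero    xs =
    cong length (filter-none odd? (All.map⁺ (All.tabulate {xs = xs} (λ {x} _ odd → odd (even-2* x)))))
  odds-stair (suc r) [] =
    trans (cong length (filter-accept odd? {xs = stair r []} (odd-suc2* r))) (cong suc (odds-stair r []))
  odds-stair (suc r) (x ∷ xs) =
    trans (cong length (filter-accept odd? {xs = stair r xs} (odd-suc2* (x + r)))) (cong suc (odds-stair r xs))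

  suc2*-injective : ∀ {a b} → suc (2 * a) ≡ suc (2 * b) → a ≡ b
  suc2*-injective {a} {b} = *-cancelˡ-≡ a b 2 ∘ suc-injective

  -- For equal lengths the entries are recovered one by one. If one list ends early, its padding
  -- zero would have to equal a positive entry of the other.
  stair-injective : ∀ r {xs ys} → All (1 ≤_) xs → All (1 ≤_) ys → stair r xs ≡ stair r ys → xs ≡ ys
  stair-injective zero    []       []       eq = refl
  stair-injective zero    {x ∷ _} {y ∷ _} (_ ∷ ps) (_ ∷ qs) eq =
    cong₂ _∷_ (*-cancelˡ-≡ x y 2 (∷-injectiveˡ eq)) (stair-injective zero ps qs (∷-injectiveʳ eq))
  stair-injective (suc r) []       []       eq = refl
  stair-injective (suc r) {x ∷ _} {y ∷ _} (_ ∷ ps) (_ ∷ qs) eq =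
    cong₂ _∷_ (+-cancelʳ-≡ r x y (suc2*-injective (∷-injectiveˡ eq))) (stair-injective r ps qs (∷-injectiveʳ eq))
  stair-injective (suc r) {[]} {suc y ∷ _} [] _ eq =
    contradiction (suc2*-injective (∷-injectiveˡ eq)) (m≢1+n+m r)
  stair-injective (suc r) {suc x ∷ _} {[]} _ [] eq =
    contradiction (sym (suc2*-injective (∷-injectiveˡ eq))) (m≢1+n+m r)

  oddsFirst⇒oddsAboveEvens : ∀ {xs} → AllPairs OddsFirst xs → OddsAboveEvens xs
  oddsFirst⇒oddsAboveEvens [] = []
  oddsFirst⇒oddsAboveEvens {x ∷ xs} (px ∷ pxs) =
    ((λ o e → contradiction e o) ∷ All.map head px) ∷ zipped px (oddsFirst⇒oddsAboveEvens pxs)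
    where
    head : ∀ {y} → OddsFirst x y → Odd x → Even y → y < x
    head (inj₁ (_ , y<x)) _ _ = y<x
    head (inj₂ (e , _))   o _ = contradiction e o
    first : ∀ {y} → OddsFirst x y → Odd y → Even x → x < y
    first (inj₁ (o , _))     _ e = contradiction e o
    first (inj₂ (_ , e , _)) o _ = contradiction e o
    zipped : ∀ {ys} → All (OddsFirst x) ys → All (λ a → All (λ b → Odd a → Even b → b < a) xs) ys →
             All (λ a → All (λ b → Odd a → Even b → b < a) (x ∷ xs)) ys
    zipped []       []       = []
    zipped (q ∷ qs) (r ∷ rs) = (first q ∷ r) ∷ zipped qs rs

  oddsFirst⇒distinctOdds : ∀ {xs} → AllPairs OddsFirst xs → DistinctOdds xs
  oddsFirst⇒distinctOdds {xs} ps = go (AllPairs.filter⁺ odd? ps) (All.all-filter odd? xs)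
    where
    go : ∀ {ys} → AllPairs OddsFirst ys → All Odd ys → Unique ys
    go []       []       = []
    go {y ∷ _} (q ∷ qs) (o ∷ os) = All.map distinct q ∷ go qs os
      where
      distinct : ∀ {z} → OddsFirst y z → y ≢ z
      distinct (inj₁ (_ , z<y)) refl = <-irrefl refl z<y
      distinct (inj₂ (e , _))   refl = contradiction e o

  oddsFirst⇒≥ : ∀ {x y} → OddsFirst x y → x ≥ y
  oddsFirst⇒≥ (inj₁ (_ , y<x))     = <⇒≤ y<x
  oddsFirst⇒≥ (inj₂ (_ , _ , y≤x)) = y≤x

  EuOd : List ℕ → Set
  EuOd xs = OddsAboveEvens xs × DistinctOdds xs

  EuOd? : Decidable EuOd
  EuOd? xs = oddsAboveEvens? xs ×-dec distinctOdds? xs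

  stair-sound : ∀ n r {N xs} → r * r + 2 * N ≡ n → IsPartition N xs →
                stair r xs ∈ filter EuOd? (partitions n)
  stair-sound n r eq (isPartition xs≥ pos s) =
    ∈-filter⁺ EuOd? (partitions-complete n
      (isPartition (AllPairs⇒Linked (AllPairs.map oddsFirst⇒≥ pairs)) (stair-positive r pos)
        (trans (sum-stair r _) (trans (cong (λ z → r * r + 2 * z) s) eq))))
      (oddsFirst⇒oddsAboveEvens pairs , oddsFirst⇒distinctOdds pairs)
    where
    pairs = stair-pairs r (Linked⇒AllPairs (flip ≤-trans) xs≥)

  stairs : ℕ × ℕ → List (List ℕ)
  stairs (r , N) = map (stair r) (partitions N)

  stairs-unique : ∀ rN → Unique (stairs rN)
  stairs-unique (r , N) = Unique-map⁺ (stair-injective r)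
    (All.tabulate (λ xs∈ → IsPartition.positive (partitions-sound N xs∈))) (partitions-unique N)

  stairs-disjoint : ∀ {rN rN′} → proj₁ rN ≢ proj₁ rN′ → Disjoint (stairs rN) (stairs rN′)
  stairs-disjoint {r , _} {r′ , _} r≢r′ (x∈ , x∈′) with ∈-map⁻ (stair r) x∈ | ∈-map⁻ (stair r′) x∈′
  ... | xs , _ , refl | ys , _ , eq =
    r≢r′ (trans (sym (odds-stair r xs)) (trans (cong (length ∘ filter odd?) eq) (odds-stair r′ ys)))

  length-concat-stairs : ∀ rNs → length (concat (map stairs rNs)) ≡ sum (map (length ∘ partitions ∘ proj₂) rNs)
  length-concat-stairs []              = refl
  length-concat-stairs ((r , N) ∷ rNs) = trans (length-++ (stairs (r , N)))
    (cong₂ _+_ (length-map (stair r) (partitions N)) (length-concat-stairs rNs))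

  -- For any choice of distinct r, the images under `stair r` are disjoint, free of repetitions, and
  -- consist of partitions counted by `p-eu^od n`.
  p-eu^od-lower : ∀ n rNs → AllPairs (λ a b → proj₁ a ≢ proj₁ b) rNs →
                  All (λ rN → proj₁ rN * proj₁ rN + 2 * proj₂ rN ≡ n) rNs →
                  sum (map (length ∘ partitions ∘ proj₂) rNs) ≤ p-eu^od n
  p-eu^od-lower n rNs distinct sums = subst (_≤ p-eu^od n) (length-concat-stairs rNs)
    (Unique-⊆⇒length≤
      (Unique.concat⁺ (All.map⁺ (All.tabulate {xs = rNs} (λ {rN} _ → stairs-unique rN)))
                      (AllPairs.map⁺ (AllPairs.map (λ {a} {b} → stairs-disjoint {a} {b}) distinct)))
      sound)
    where
    sound : concat (map stairs rNs) ⊆ filter EuOd? (partitions n)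
    sound x∈ with ∈-concat⁻′ (map stairs rNs) x∈
    ... | block , x∈block , block∈ with ∈-map⁻ stairs block∈
    ... | (r , N) , rN∈ , refl with ∈-map⁻ (stair r) x∈block
    ... | xs , xs∈ , refl = stair-sound n r (All.lookup sums rN∈) (partitions-sound N xs∈)

  -- Upper bound: even parts above odd parts, by halving.

  data Parity : ℕ → Set where
    even : ∀ b → Parity (2 * b)
    odd  : ∀ b → Parity (suc (2 * b))

  parity : ∀ x → Parity x
  parity zero = even 0
  parity (suc x) with parity x
  ... | even b = odd b
  ... | odd  b = subst Parity (*-suc 2 b) (even (suc b))

  EvensFirst : ℕ → ℕ → Set
  EvensFirst x y = (Odd x × Odd y × y < x) ⊎ (Even x × y ≤ x)

  evensFirst : ∀ {xs} → AllPairs _≥_ xs → EvensAboveOdds xs → DistinctOdds xs → AllPairs EvensFirst xs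
  evensFirst []         _              _ = []
  evensFirst {x ∷ xs} (x≥ ∷ xs≥) (_ ∷ rows) distinct =
    All.tabulate (λ y∈ → first y∈ (even? x)) ∷ evensFirst xs≥ (All.map All.tail rows) (tail (odd? x))
    where
    tail : _ → DistinctOdds xs
    tail (yes o) = AllPairs.tail (subst Unique (filter-accept odd? o) distinct)
    tail (no ¬o) = subst Unique (filter-reject odd? ¬o) distinct
    first : ∀ {y} → y ∈ xs → _ → EvensFirst x y
    first y∈ (yes e) = inj₂ (e , All.lookup x≥ y∈)
    first {y} y∈ (no o) = inj₁ (o , o′ , ≤∧≢⇒< (All.lookup x≥ y∈) (≢-sym x≢y))
      where
      o′ : Odd y
      -- An even y would have to exceed the odd x, although it stands after x in a non-increasing
      -- list.
      o′ e = <⇒≱ (All.lookup (All.lookup rows y∈) (here refl) e o) (All.lookup x≥ y∈)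
      x≢y : x ≢ y
      x≢y = All.lookup (AllPairs.head (subst Unique (filter-accept odd? o) distinct)) (∈-filter⁺ odd? y∈ o′)

  suc2* : ℕ → ℕ
  suc2* b = suc (2 * b)

  -- μ holds the halves of the even parts and ν those of the odd parts greater than 1. A part 1 has
  -- half 0, which is no part, so its multiplicity e is kept separately.
  record Halves (xs : List ℕ) : Set where
    constructor halves
    field
      μ ν      : List ℕ
      e        : ℕ
      e≤1      : e ≤ 1
      xs≡      : xs ≡ map (2 *_) μ ++ map suc2* ν ++ replicate e 1
      μ≥       : AllPairs _≥_ μ
      ν>       : AllPairs _>_ ν
      μ-pos    : All (1 ≤_) μ
      ν-pos    : All (1 ≤_) ν
      μ-above  : All (λ a → All (_< a) ν) μ

  halve : ∀ {xs} → AllPairs EvensFirst xs → All (1 ≤_) xs → Halves xs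
  halve [] [] = halves [] [] 0 z≤n refl [] [] [] [] []
  halve {x ∷ _} (px ∷ pairs) (x>0 ∷ pos) with parity x | halve pairs pos
  ... | even zero | _ = contradiction x>0 λ ()
  ... | even b@(suc _) | halves μ ν e e≤1 refl μ≥ ν> μ-pos ν-pos μ-above =
    halves (b ∷ μ) ν e e≤1 refl
      (All.map (λ {a} r → *-cancelˡ-≤ 2 (below r)) (All.map⁻ (All.++⁻ˡ (map (2 *_) μ) px)) ∷ μ≥)
      ν> (s≤s z≤n ∷ μ-pos) ν-pos
      (All.map (λ {c} r → *-cancelˡ-< 2 c b (below r))
        (All.map⁻ (All.++⁻ˡ (map suc2* ν) (All.++⁻ʳ (map (2 *_) μ) px))) ∷ μ-above)
    where
    below : ∀ {y} → EvensFirst (2 * b) y → y ≤ 2 * b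
    below (inj₁ (o , _))   = contradiction (even-2* b) o
    below (inj₂ (_ , y≤x)) = y≤x
  ... | odd b | halves (a ∷ μ) ν e e≤1 refl μ≥ ν> μ-pos ν-pos μ-above with px
  ...   | inj₁ (_ , o , _) ∷ _ = contradiction (even-2* a) o
  ...   | inj₂ (e , _)     ∷ _ = contradiction e (odd-suc2* b)
  -- The head is 1. Later odd parts would have to be smaller and even parts cannot follow an odd
  -- one, so nothing follows.
  halve (px ∷ pairs) (x>0 ∷ pos) | odd zero | halves [] [] zero e≤1 refl μ≥ ν> μ-pos ν-pos μ-above =
    halves [] [] 1 ≤-refl refl [] [] [] [] []
  halve (px ∷ pairs) (x>0 ∷ pos) | odd zero | halves [] [] (suc e) e≤1 refl μ≥ ν> μ-pos ν-pos μ-above with px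
  ... | inj₁ (_ , _ , s≤s ()) ∷ _
  ... | inj₂ (e , _)    ∷ _ = contradiction e (odd-suc2* 0)
  halve (px ∷ pairs) (x>0 ∷ pos) | odd zero | halves [] (c ∷ ν) e e≤1 refl μ≥ ν> μ-pos ν-pos μ-above with px
  ... | inj₁ (_ , _ , s≤s ()) ∷ _
  ... | inj₂ (e , _)    ∷ _ = contradiction e (odd-suc2* 0)
  halve (px ∷ pairs) (x>0 ∷ pos) | odd b@(suc _) | halves [] ν e e≤1 refl μ≥ ν> μ-pos ν-pos μ-above =
    halves [] (b ∷ ν) e e≤1 refl [] (All.map (λ {c} r → *-cancelˡ-< 2 c b (≤-pred (below r)))
        (All.map⁻ (All.++⁻ˡ (map suc2* ν) px)) ∷ ν>) [] (s≤s z≤n ∷ ν-pos) []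
    where
    below : ∀ {y} → EvensFirst (suc2* b) y → y < suc2* b
    below (inj₁ (_ , _ , y<x)) = y<x
    below (inj₂ (e , _))       = contradiction e (odd-suc2* b)

  -- Distinct positive integers below a number at most a - 1. Hence the half of an even part exceeds
  -- the number r of odd parts greater than 1, and no half up to r is repeated.
  length<bound : ∀ {a ν} → AllPairs _>_ ν → All (1 ≤_) ν → All (_< a) ν → 1 ≤ a → length ν < a
  length<bound []         []           []          a>0 = a>0
  length<bound (c> ∷ ν>) (c>0 ∷ ν-pos) (c<a ∷ _) _   = ≤-<-trans (length<bound ν> ν-pos c> c>0) c<a

  -- Doubles all entries but the last r, which are turned into odd numbers.
  unhalve : ℕ → List ℕ → List ℕ
  unhalve r []       = []
  unhalve r (a ∷ xs) with length xs <? r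
  ... | yes _ = suc2* a ∷ unhalve r xs
  ... | no  _ = 2 * a   ∷ unhalve r xs

  -- The part 1 leaves no trace among the halves; it is restored from the total n.
  decode : ℕ → ℕ → List ℕ → List ℕ
  decode n r xs = unhalve r xs ++ replicate (n ∸ sum (unhalve r xs)) 1

  unhalve-odd : ∀ r ν → length ν ≤ r → unhalve r ν ≡ map suc2* ν
  unhalve-odd r []      _ = refl
  unhalve-odd r (c ∷ ν) len with length ν <? r
  ... | yes _  = cong (suc2* c ∷_) (unhalve-odd r ν (<⇒≤ len))
  ... | no  ≮r = contradiction len ≮r

  unhalve-++ : ∀ μ ν → unhalve (length ν) (μ ++ ν) ≡ map (2 *_) μ ++ map suc2* ν
  unhalve-++ []      ν = unhalve-odd (length ν) ν ≤-refl
  unhalve-++ (a ∷ μ) ν with length (μ ++ ν) <? length ν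
  ... | yes lt = contradiction (subst (length ν ≤_) (sym (length-++ μ)) (m≤n+m (length ν) (length μ))) (<⇒≱ lt)
  ... | no  _  = cong (2 * a ∷_) (unhalve-++ μ ν)

  sum-suc2* : ∀ ν → sum (map suc2* ν) ≡ 2 * sum ν + length ν
  sum-suc2* []      = refl
  sum-suc2* (c ∷ ν) = trans (cong (suc2* c +_) (sum-suc2* ν)) (eq c (sum ν) (length ν))
    where
    eq : ∀ c s l → suc (2 * c) + (2 * s + l) ≡ 2 * (c + s) + suc l
    eq = solve-∀

  sum-ones : ∀ e → sum (replicate e 1) ≡ e
  sum-ones zero    = refl
  sum-ones (suc e) = cong suc (sum-ones e)

  ⌊e+2*s/2⌋ : ∀ {e} s → e ≤ 1 → ⌊ e + 2 * s /2⌋ ≡ s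
  ⌊e+2*s/2⌋ zero    z≤n       = refl
  ⌊e+2*s/2⌋ zero    (s≤s z≤n) = refl
  ⌊e+2*s/2⌋ {e} (suc s) e≤1 rewrite *-suc 2 s | +-suc e (suc (2 * s)) | +-suc e (2 * s) =
    cong suc (⌊e+2*s/2⌋ s e≤1)

  EuAboveOd : List ℕ → Set
  EuAboveOd xs = EvensAboveOdds xs × DistinctOdds xs

  EuAboveOd? : Decidable EuAboveOd
  EuAboveOd? xs = evensAboveOdds? xs ×-dec distinctOdds? xs

  -- Capping the distinctness condition at 3 leaves the four polynomials `Q 0`, ..., `Q 3` for all
  -- r, which makes the sum over r tractable.
  candidates : ℕ → ℕ → List (List ℕ)
  candidates n r = map (decode n r) (enum n (3 ⊓ r) n ⌊ n ∸ r /2⌋)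

  halves-candidate : ∀ n {xs} → sum xs ≡ n → Halves xs → xs ∈ concat (applyUpTo (candidates n) (suc n))
  halves-candidate n s (halves μ ν e e≤1 refl μ≥ ν> μ-pos ν-pos μ-above) =
    ∈-concat⁺′ (subst (_∈ candidates n r) decoded (∈-map⁺ (decode n r) member))
               (∈-applyUpTo⁺ (candidates n) (s≤s (subst (r ≤_) (sym n≡) (m≤m+n r _))))
    where
    r = length ν
    xs = μ ++ ν
    pieces : ∀ a b l e → 2 * a + (2 * b + l + e) ≡ l + (e + 2 * (a + b))
    pieces = solve-∀
    n≡ : n ≡ r + (e + 2 * sum xs)
    n≡ = begin
      n ≡⟨ s ⟨
      sum (map (2 *_) μ ++ map suc2* ν ++ replicate e 1)
        ≡⟨ sum-++ (map (2 *_) μ) _ ⟩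
      sum (map (2 *_) μ) + sum (map suc2* ν ++ replicate e 1)
        ≡⟨ cong₂ _+_ (sum-map-2* μ) (trans (sum-++ (map suc2* ν) _) (cong₂ _+_ (sum-suc2* ν) (sum-ones e))) ⟩
      2 * sum μ + (2 * sum ν + r + e)
        ≡⟨ pieces (sum μ) (sum ν) r e ⟩
      r + (e + 2 * (sum μ + sum ν))
        ≡⟨ cong (λ z → r + (e + 2 * z)) (sum-++ μ ν) ⟨
      r + (e + 2 * sum xs) ∎
      where open ≡-Reasoning
    -- Since e ≤ 1, rounding down discards exactly the possible part 1.
    half : sum xs ≡ ⌊ n ∸ r /2⌋
    half = begin
      sum xs                          ≡⟨ ⌊e+2*s/2⌋ (sum xs) e≤1 ⟨
      ⌊ e + 2 * sum xs /2⌋            ≡⟨ cong ⌊_/2⌋ (m+n∸m≡n r (e + 2 * sum xs)) ⟨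
      ⌊ r + (e + 2 * sum xs) ∸ r /2⌋  ≡⟨ cong (λ z → ⌊ z ∸ r /2⌋) n≡ ⟨
      ⌊ n ∸ r /2⌋                     ∎
      where open ≡-Reasoning
    pos : All (1 ≤_) xs
    pos = All.++⁺ μ-pos ν-pos
    pairs : AllPairs (DistinctUpTo (3 ⊓ r)) xs
    pairs = AllPairs.++⁺ (evens μ≥ μ-pos μ-above) (AllPairs.map inj₁ ν>) (All.map (All.map inj₁) μ-above)
      where
      evens : ∀ {ys} → AllPairs _≥_ ys → All (1 ≤_) ys → All (λ a → All (_< a) ν) ys →
              AllPairs (DistinctUpTo (3 ⊓ r)) ys
      evens []       []       []       = []
      evens (q ∷ qs) (a>0 ∷ ps) (ν<a ∷ as) =
        All.map (λ b≤a → inj₂ (b≤a , ≤-<-trans (m⊓n≤n 3 r) (length<bound ν> ν-pos ν<a a>0))) q ∷ evens qs ps as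
    xs≥ : AllPairs _≥_ xs
    xs≥ = AllPairs.map DistinctUpTo⇒≤ pairs
    sum≤n : sum xs ≤ n
    sum≤n = subst (_≤ n) (sym half) (≤-trans (⌊n/2⌋≤n (n ∸ r)) (m∸n≤m n r))
    member : xs ∈ enum n (3 ⊓ r) n ⌊ n ∸ r /2⌋
    member = enum-complete n (3 ⊓ r) n ⌊ n ∸ r /2⌋ pairs pos half
      (All.map (λ x≤ → ≤-trans x≤ sum≤n) (parts≤sum xs (AllPairs⇒Linked xs≥)))
      (≤-trans (length≤sum pos) sum≤n)
    decoded : decode n r xs ≡ map (2 *_) μ ++ map suc2* ν ++ replicate e 1
    decoded rewrite unhalve-++ μ ν = trans
      (cong (λ z → (map (2 *_) μ ++ map suc2* ν) ++ replicate z 1) rest)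
      (++-assoc (map (2 *_) μ) (map suc2* ν) (replicate e 1))
      where
      rest : n ∸ sum (map (2 *_) μ ++ map suc2* ν) ≡ e
      rest = trans (cong (_∸ sum (map (2 *_) μ ++ map suc2* ν)) (trans (sym s)
        (trans (cong sum (sym (++-assoc (map (2 *_) μ) (map suc2* ν) (replicate e 1))))
          (sum-++ (map (2 *_) μ ++ map suc2* ν) (replicate e 1)))))
        (trans (m+n∸m≡n (sum (map (2 *_) μ ++ map suc2* ν)) _) (sum-ones e))

  -- Every counted partition is decoded from its own halves. The candidates may also contain other
  -- lists, which is harmless for an upper bound.
  p-od^eu-upper : ∀ n → p-od^eu n ≤ length (concat (applyUpTo (candidates n) (suc n)))
  p-od^eu-upper n = Unique-⊆⇒length≤ (Unique.filter⁺ EuAboveOd? (partitions-unique n)) covered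
    where
    covered : filter EuAboveOd? (partitions n) ⊆ concat (applyUpTo (candidates n) (suc n))
    covered xs∈ with ∈-filter⁻ EuAboveOd? {xs = partitions n} xs∈
    ... | xs∈′ , above , distinct with partitions-sound n xs∈′
    ... | isPartition xs≥ pos s =
      halves-candidate n s (halve (evensFirst (Linked⇒AllPairs (flip ≤-trans) xs≥) above distinct) pos)

-- Summation over r and comparison of the bounds.

module Comparison where

  open PowerSeries
  open Counting
  open Encodings
  open import Data.Nat as ℕ using (zero; suc; z≤n; s≤s; ⌊_/2⌋; _⊓_)
  import Data.Nat.Properties as ℕ
  import Data.Nat.Tactic.RingSolver as ℕ-Solver
  open import Data.Integer using (ℤ; +_; -_; 0ℤ; 1ℤ; _+_; _*_; _≤_; +≤+)
  import Data.Integer.Properties as ℤ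
  open import Data.Integer.Tactic.RingSolver using (solve-∀)
  open import Data.List using (List; []; _∷_; length; concat; applyUpTo)
  open import Data.List.Properties using (length-++; length-map)
  open import Data.List.Relation.Unary.All using (All; []; _∷_)
  open import Data.List.Relation.Unary.AllPairs using (AllPairs; []; _∷_)
  open import Data.Product using (_,_; proj₁; proj₂)
  open import Data.Unit using (tt)
  open import Function using (_∘_)
  open import Relation.Binary.PropositionalEquality

  Σ< : ℕ → (ℕ → ℤ) → ℤ
  Σ< zero    f = 0ℤ
  Σ< (suc k) f = f 0 + Σ< k (f ∘ suc)

  Σ<-cong : ∀ k {f g} → f ≗ g → Σ< k f ≡ Σ< k g
  Σ<-cong zero    e = refl
  Σ<-cong (suc k) e = cong₂ _+_ (e 0) (Σ<-cong k (e ∘ suc))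

  length-concat-applyUpTo : ∀ {A : Set} (f : ℕ → List A) k →
    + length (concat (applyUpTo f k)) ≡ Σ< k (λ r → + length (f r))
  length-concat-applyUpTo f zero    = refl
  length-concat-applyUpTo f (suc k) = trans (cong +_ (length-++ (f 0)))
    (cong (λ z → + length (f 0) + z) (length-concat-applyUpTo (f ∘ suc) k))

  -- As 3 ≤ n, level n is at least 3 ⊓ r, so `v-conv` applies and the series `p n` is the same for
  -- all r.
  length-candidates : ∀ n r → 3 ℕ.≤ n → + length (candidates n r) ≡ conv (Q (3 ⊓ r)) (p n) ⌊ n ℕ.∸ r /2⌋
  length-candidates n r 3≤n = begin
    + length (candidates n r)       ≡⟨ cong +_ (length-map (decode n r) (enum n i n N)) ⟩
    + length (enum n i n N)         ≡⟨ length-enum n i n N (ℕ.≤-trans (ℕ.⌊n/2⌋≤n (n ℕ.∸ r)) (ℕ.m∸n≤m n r)) ⟩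
    v i n N                         ≡⟨ cong (λ k → v i k N) i+ ⟨
    v i (n ℕ.∸ i ℕ.+ i) N           ≡⟨ v-conv i (n ℕ.∸ i) N ⟩
    conv (Q i) (p (n ℕ.∸ i ℕ.+ i)) N ≡⟨ cong (λ k → conv (Q i) (p k) N) i+ ⟩
    conv (Q i) (p n) N              ∎
    where
    open ≡-Reasoning
    i = 3 ⊓ r
    N = ⌊ n ℕ.∸ r /2⌋
    i+ : n ℕ.∸ i ℕ.+ i ≡ n
    i+ = ℕ.m∸n+n≡m (ℕ.≤-trans (ℕ.m⊓n≤m 3 r) 3≤n)

  -- Consecutive r share the value of ⌊ (n - r) / 2 ⌋, so from r = 3 on the sum is twice a partial sum
  -- of g 3, up to one unpaired term.
  module HalvedSum (g : ℕ → Seq) (S : Seq) (g₃-differences : ∀ n → g 3 n ≡ S n + - 1ℤ * shift 1 S n) where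

    halvedSum : ℕ → ℤ
    halvedSum n = Σ< (suc n) (λ r → g (3 ⊓ r) ⌊ n ℕ.∸ r /2⌋)

    private
      tail : ℕ → ℤ
      tail n = Σ< (suc n) (λ r → g 3 ⌊ n ℕ.∸ r /2⌋)

      half₀ : ∀ j → ⌊ 2 ℕ.* j /2⌋ ≡ j
      half₀ j = ⌊e+2*s/2⌋ {0} j z≤n

      half₁ : ∀ j → ⌊ suc (2 ℕ.* j) /2⌋ ≡ j
      half₁ j = ⌊e+2*s/2⌋ {1} j (s≤s z≤n)

      -- The halves run through j, j, ..., 0, 0, and the sum of `g 3` over 0, ..., j telescopes to
      -- `S j`.
      tail-odd : ∀ j → tail (suc (2 ℕ.* j)) ≡ + 2 * S j
      tail-odd zero = trans (cong (λ z → z + (z + 0ℤ)) (g₃-differences 0)) (eq (S 0))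
        where
        eq : ∀ s → (s + - 1ℤ * 0ℤ) + ((s + - 1ℤ * 0ℤ) + 0ℤ) ≡ + 2 * s
        eq = solve-∀
      tail-odd (suc j) = begin
        tail (suc (2 ℕ.* suc j))
          ≡⟨ cong (tail ∘ suc) (ℕ.*-suc 2 j) ⟩
        g 3 (suc ⌊ suc (2 ℕ.* j) /2⌋) + (g 3 (suc ⌊ 2 ℕ.* j /2⌋) + tail (suc (2 ℕ.* j)))
          ≡⟨ cong₂ (λ a b → g 3 (suc a) + (g 3 (suc b) + tail (suc (2 ℕ.* j)))) (half₁ j) (half₀ j) ⟩
        g 3 (suc j) + (g 3 (suc j) + tail (suc (2 ℕ.* j)))
          ≡⟨ cong₂ (λ x y → x + (x + y)) (g₃-differences (suc j)) (tail-odd j) ⟩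
        (S (suc j) + - 1ℤ * S j) + ((S (suc j) + - 1ℤ * S j) + + 2 * S j)
          ≡⟨ eq (S (suc j)) (S j) ⟩
        + 2 * S (suc j) ∎
        where
        open ≡-Reasoning
        eq : ∀ s t → (s + - 1ℤ * t) + ((s + - 1ℤ * t) + + 2 * t) ≡ + 2 * s
        eq = solve-∀

      -- Here the half j is attained once and every smaller value twice, hence the correction by
      -- `g 3 j`.
      tail-even : ∀ j → tail (2 ℕ.* j) ≡ + 2 * S j + - 1ℤ * g 3 j
      tail-even zero = begin
        g 3 0 + 0ℤ                              ≡⟨ cong (_+ 0ℤ) (g₃-differences 0) ⟩
        S 0 + - 1ℤ * 0ℤ + 0ℤ                    ≡⟨ eq (S 0) ⟩
        + 2 * S 0 + - 1ℤ * (S 0 + - 1ℤ * 0ℤ)    ≡⟨ cong (λ x → + 2 * S 0 + - 1ℤ * x) (g₃-differences 0) ⟨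
        + 2 * S 0 + - 1ℤ * g 3 0                ∎
        where
        open ≡-Reasoning
        eq : ∀ s → s + - 1ℤ * 0ℤ + 0ℤ ≡ + 2 * s + - 1ℤ * (s + - 1ℤ * 0ℤ)
        eq = solve-∀
      tail-even (suc j) = begin
        tail (2 ℕ.* suc j)
          ≡⟨ cong tail (ℕ.*-suc 2 j) ⟩
        g 3 (suc ⌊ 2 ℕ.* j /2⌋) + (g 3 ⌊ suc (2 ℕ.* j) /2⌋ + tail (2 ℕ.* j))
          ≡⟨ cong₂ (λ a b → g 3 (suc a) + (g 3 b + tail (2 ℕ.* j))) (half₀ j) (half₁ j) ⟩
        g 3 (suc j) + (g 3 j + tail (2 ℕ.* j))
          ≡⟨ cong₂ (λ x y → x + (g 3 j + y)) (g₃-differences (suc j)) (tail-even j) ⟩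
        S (suc j) + - 1ℤ * S j + (g 3 j + (+ 2 * S j + - 1ℤ * g 3 j))
          ≡⟨ eq (S (suc j)) (S j) (g 3 j) ⟩
        + 2 * S (suc j) + - 1ℤ * (S (suc j) + - 1ℤ * S j)
          ≡⟨ cong (λ x → + 2 * S (suc j) + - 1ℤ * x) (g₃-differences (suc j)) ⟨
        + 2 * S (suc j) + - 1ℤ * g 3 (suc j) ∎
        where
        open ≡-Reasoning
        eq : ∀ s t y → s + - 1ℤ * t + (y + (+ 2 * t + - 1ℤ * y)) ≡ + 2 * s + - 1ℤ * (s + - 1ℤ * t)
        eq = solve-∀

    -- Splitting off r = 0, 1, 2 leaves `tail` at n - 3, which is odd for even n and even for odd n;
    -- this decides which of the two tail formulas enters.
    halvedSum-even : ∀ j → halvedSum (2 ℕ.* (2 ℕ.+ j)) ≡ g 0 (2 ℕ.+ j) + g 1 (suc j) + g 2 (suc j) + + 2 * S j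
    halvedSum-even j = begin
      halvedSum (2 ℕ.* (2 ℕ.+ j))
        ≡⟨ cong halvedSum (trans (ℕ.*-suc 2 (suc j)) (cong (2 ℕ.+_) (ℕ.*-suc 2 j))) ⟩
      g 0 (2 ℕ.+ ⌊ 2 ℕ.* j /2⌋) + (g 1 (suc ⌊ suc (2 ℕ.* j) /2⌋) + (g 2 (suc ⌊ 2 ℕ.* j /2⌋) + tail (suc (2 ℕ.* j))))
        ≡⟨ cong₂ (λ a b → g 0 (2 ℕ.+ a) + (g 1 (suc b) + (g 2 (suc a) + tail (suc (2 ℕ.* j))))) (half₀ j) (half₁ j) ⟩
      g 0 (2 ℕ.+ j) + (g 1 (suc j) + (g 2 (suc j) + tail (suc (2 ℕ.* j))))
        ≡⟨ cong (λ z → g 0 (2 ℕ.+ j) + (g 1 (suc j) + (g 2 (suc j) + z))) (tail-odd j) ⟩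
      g 0 (2 ℕ.+ j) + (g 1 (suc j) + (g 2 (suc j) + + 2 * S j))
        ≡⟨ eq (g 0 (2 ℕ.+ j)) (g 1 (suc j)) (g 2 (suc j)) (+ 2 * S j) ⟩
      g 0 (2 ℕ.+ j) + g 1 (suc j) + g 2 (suc j) + + 2 * S j ∎
      where
      open ≡-Reasoning
      eq : ∀ a b c d → a + (b + (c + d)) ≡ a + b + c + d
      eq = solve-∀

    halvedSum-odd : ∀ j → halvedSum (suc (2 ℕ.* suc j)) ≡ g 0 (suc j) + g 1 (suc j) + g 2 j + (+ 2 * S j + - 1ℤ * g 3 j)
    halvedSum-odd j = begin
      halvedSum (suc (2 ℕ.* suc j))
        ≡⟨ cong (halvedSum ∘ suc) (ℕ.*-suc 2 j) ⟩
      g 0 (suc ⌊ suc (2 ℕ.* j) /2⌋) + (g 1 (suc ⌊ 2 ℕ.* j /2⌋) + (g 2 ⌊ suc (2 ℕ.* j) /2⌋ + tail (2 ℕ.* j)))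
        ≡⟨ cong₂ (λ a b → g 0 (suc b) + (g 1 (suc a) + (g 2 b + tail (2 ℕ.* j)))) (half₀ j) (half₁ j) ⟩
      g 0 (suc j) + (g 1 (suc j) + (g 2 j + tail (2 ℕ.* j)))
        ≡⟨ cong (λ z → g 0 (suc j) + (g 1 (suc j) + (g 2 j + z))) (tail-even j) ⟩
      g 0 (suc j) + (g 1 (suc j) + (g 2 j + (+ 2 * S j + - 1ℤ * g 3 j)))
        ≡⟨ eq (g 0 (suc j)) (g 1 (suc j)) (g 2 j) (+ 2 * S j + - 1ℤ * g 3 j) ⟩
      g 0 (suc j) + g 1 (suc j) + g 2 j + (+ 2 * S j + - 1ℤ * g 3 j) ∎
      where
      open ≡-Reasoning
      eq : ∀ a b c d → a + (b + (c + d)) ≡ a + b + c + d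
      eq = solve-∀

  -- Both bounds as polynomial multiples of one series.

  -- S₃ = (1 + x)(1 - x⁴)(1 - x⁶), that is, Q 3 = (1 - x) S₃.
  S₃ : Poly
  S₃ = (1ℤ ∷ 1ℤ ∷ []) +ₚ - 1ℤ ·ₚ x^ 4 · (1ℤ ∷ 1ℤ ∷ 1ℤ ∷ 1ℤ ∷ []) +ₚ x^ 10 · (1ℤ ∷ 1ℤ ∷ [])

  -- The bounds on p-od^eu n and p-eu^od n as multiples of p n, read off at ⌊ n / 2 ⌋; the lower ones
  -- keep r = 0, 2, 4 and r = 1, 3, 5 odd parts.
  upper-even upper-odd lower-even lower-odd : Poly
  upper-even = Q 0 +ₚ x^ 1 · Q 1 +ₚ x^ 1 · Q 2 +ₚ x^ 2 · ((+ 2) ·ₚ S₃)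
  upper-odd  = Q 0 +ₚ Q 1 +ₚ x^ 1 · Q 2 +ₚ x^ 1 · ((+ 2) ·ₚ S₃ +ₚ - 1ℤ ·ₚ Q 3)
  lower-even = Q 0 +ₚ x^ 2 · Q 0 +ₚ x^ 8 · Q 0
  lower-odd  = Q 0 +ₚ x^ 4 · Q 0 +ₚ x^ 12 · Q 0

  S₃-differences : ∀ f n → conv (Q 3) f n ≡ conv S₃ f n + - 1ℤ * shift 1 (conv S₃ f) n
  -- `Q 3` and `S₃ +ₚ - 1ℤ ·ₚ x^ 1 · S₃` evaluate to the same list of coefficients.
  S₃-differences f n = trans (conv-+ₚ S₃ (- 1ℤ ·ₚ x^ 1 · S₃) f n)
    (cong (λ z → conv S₃ f n + z)
      (trans (conv-·ₚ (- 1ℤ) (x^ 1 · S₃) f n) (cong (λ z → - 1ℤ * z) (conv-x^ 1 S₃ f n))))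

  module _ (f : Seq) where
    open HalvedSum (λ i → conv (Q i) f) (conv S₃ f) (S₃-differences f)

    upper-even-sum : ∀ j → halvedSum (2 ℕ.* (2 ℕ.+ j)) ≡ conv upper-even f (2 ℕ.+ j)
    upper-even-sum j = trans (halvedSum-even j) (sym (begin
      conv upper-even f m
        ≡⟨ conv-x^+ₚ (Q 0 +ₚ x^ 1 · Q 1 +ₚ x^ 1 · Q 2) 2 ((+ 2) ·ₚ S₃) f m ⟩
      conv (Q 0 +ₚ x^ 1 · Q 1 +ₚ x^ 1 · Q 2) f m + conv ((+ 2) ·ₚ S₃) f j
        ≡⟨ cong₂ _+_ (trans (conv-x^+ₚ (Q 0 +ₚ x^ 1 · Q 1) 1 (Q 2) f m)
                            (cong (_+ conv (Q 2) f (suc j)) (conv-x^+ₚ (Q 0) 1 (Q 1) f m)))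
                     (conv-·ₚ (+ 2) S₃ f j) ⟩
      conv (Q 0) f m + conv (Q 1) f (suc j) + conv (Q 2) f (suc j) + + 2 * conv S₃ f j ∎))
      where
      open ≡-Reasoning
      m = 2 ℕ.+ j

    upper-odd-sum : ∀ j → halvedSum (suc (2 ℕ.* suc j)) ≡ conv upper-odd f (suc j)
    upper-odd-sum j = trans (halvedSum-odd j) (sym (begin
      conv upper-odd f m
        ≡⟨ conv-x^+ₚ (Q 0 +ₚ Q 1 +ₚ x^ 1 · Q 2) 1 ((+ 2) ·ₚ S₃ +ₚ - 1ℤ ·ₚ Q 3) f m ⟩
      conv (Q 0 +ₚ Q 1 +ₚ x^ 1 · Q 2) f m + conv ((+ 2) ·ₚ S₃ +ₚ - 1ℤ ·ₚ Q 3) f j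
        ≡⟨ cong₂ _+_ (trans (conv-x^+ₚ (Q 0 +ₚ Q 1) 1 (Q 2) f m)
                            (cong (_+ conv (Q 2) f j) (conv-+ₚ (Q 0) (Q 1) f m)))
                     (trans (conv-+ₚ ((+ 2) ·ₚ S₃) (- 1ℤ ·ₚ Q 3) f j)
                            (cong₂ _+_ (conv-·ₚ (+ 2) S₃ f j) (conv-·ₚ (- 1ℤ) (Q 3) f j))) ⟩
      conv (Q 0) f m + conv (Q 1) f m + conv (Q 2) f j + (+ 2 * conv S₃ f j + - 1ℤ * conv (Q 3) f j) ∎))
      where
      open ≡-Reasoning
      m = suc j

  p-od^eu-upper-Σ : ∀ n → 3 ℕ.≤ n → + p-od^eu n ≤ Σ< (suc n) (λ r → conv (Q (3 ⊓ r)) (p n) ⌊ n ℕ.∸ r /2⌋)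
  p-od^eu-upper-Σ n 3≤n = ℤ.≤-trans (+≤+ (p-od^eu-upper n)) (ℤ.≤-reflexive
    (trans (length-concat-applyUpTo (candidates n) (suc n)) (Σ<-cong (suc n) (λ r → length-candidates n r 3≤n))))

  p-od^eu-even : ∀ m → 2 ℕ.≤ m → + p-od^eu (2 ℕ.* m) ≤ conv upper-even (p (2 ℕ.* m)) m
  p-od^eu-even m@(suc (suc j)) (s≤s (s≤s z≤n)) =
    ℤ.≤-trans (p-od^eu-upper-Σ (2 ℕ.* m) (ℕ.≤-trans (s≤s (s≤s (s≤s z≤n))) (ℕ.*-monoʳ-≤ 2 {2} {m} (s≤s (s≤s z≤n)))))
              (ℤ.≤-reflexive (upper-even-sum (p (2 ℕ.* m)) j))

  p-od^eu-odd : ∀ m → 1 ℕ.≤ m → + p-od^eu (suc (2 ℕ.* m)) ≤ conv upper-odd (p (suc (2 ℕ.* m))) m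
  p-od^eu-odd m@(suc j) (s≤s z≤n) =
    ℤ.≤-trans (p-od^eu-upper-Σ (suc (2 ℕ.* m)) (s≤s (ℕ.*-monoʳ-≤ 2 {1} {m} (s≤s z≤n))))
              (ℤ.≤-reflexive (upper-odd-sum (p (suc (2 ℕ.* m))) j))

  -- In both uses m = ⌊n/2⌋, and r odd parts leave a partition of m - ⌊r²/2⌋. The shifts are
  -- therefore 0, 2, 8 for r = 0, 2, 4 and 0, 4, 12 for r = 1, 3, 5.
  p-eu^od-three-stairs : ∀ n a b N₀ N₁ N₂ r₀ r₁ r₂ → AllPairs (λ a b → proj₁ a ≢ proj₁ b) ((r₀ , N₀) ∷ (r₁ , N₁) ∷ (r₂ , N₂) ∷ []) →
    All (λ rN → proj₁ rN ℕ.* proj₁ rN ℕ.+ 2 ℕ.* proj₂ rN ≡ n) ((r₀ , N₀) ∷ (r₁ , N₁) ∷ (r₂ , N₂) ∷ []) →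
    ∀ m → shift 0 (p n) m ≡ p n N₀ → shift a (p n) m ≡ p n N₁ → shift b (p n) m ≡ p n N₂ →
    conv (Q 0 +ₚ x^ a · Q 0 +ₚ x^ b · Q 0) (p n) m ≤ + p-eu^od n
  p-eu^od-three-stairs n a b N₀ N₁ N₂ r₀ r₁ r₂ distinct sums@(s₀ ∷ s₁ ∷ s₂ ∷ []) m e₀ e₁ e₂ =
    ℤ.≤-trans (ℤ.≤-reflexive eq) (+≤+ (p-eu^od-lower n _ distinct sums))
    where
    N≤ : ∀ {r N} → r ℕ.* r ℕ.+ 2 ℕ.* N ≡ n → N ℕ.≤ n
    N≤ {r} {N} s = subst (N ℕ.≤_) s (ℕ.≤-trans (ℕ.m≤m+n N (N ℕ.+ 0)) (ℕ.m≤n+m (2 ℕ.* N) (r ℕ.* r)))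
    P = length ∘ partitions
    term : ∀ {j r N} → shift j (p n) m ≡ p n N → r ℕ.* r ℕ.+ 2 ℕ.* N ≡ n → shift j (conv (Q 0) (p n)) m ≡ + P N
    term {j} {r} e s = trans (shift-cong j (conv-1 (p n)) m) (trans e (sym (length-partitions (N≤ {r} s))))
    eq : conv (Q 0 +ₚ x^ a · Q 0 +ₚ x^ b · Q 0) (p n) m ≡ + (P N₀ ℕ.+ (P N₁ ℕ.+ (P N₂ ℕ.+ 0)))
    eq = begin
      conv (Q 0 +ₚ x^ a · Q 0 +ₚ x^ b · Q 0) (p n) m
        ≡⟨ conv-x^+ₚ (Q 0 +ₚ x^ a · Q 0) b (Q 0) (p n) m ⟩
      conv (Q 0 +ₚ x^ a · Q 0) (p n) m + shift b (conv (Q 0) (p n)) m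
        ≡⟨ cong₂ _+_ (conv-x^+ₚ (Q 0) a (Q 0) (p n) m) (term {b} {r₂} e₂ s₂) ⟩
      conv (Q 0) (p n) m + shift a (conv (Q 0) (p n)) m + + P N₂
        ≡⟨ cong (_+ + P N₂) (cong₂ _+_ (term {0} {r₀} e₀ s₀) (term {a} {r₁} e₁ s₁)) ⟩
      + (P N₀ ℕ.+ P N₁ ℕ.+ P N₂)
        ≡⟨ cong +_ (trans (ℕ.+-assoc (P N₀) (P N₁) (P N₂)) (cong (λ z → P N₀ ℕ.+ (P N₁ ℕ.+ z)) (sym (ℕ.+-identityʳ (P N₂))))) ⟩
      + (P N₀ ℕ.+ (P N₁ ℕ.+ (P N₂ ℕ.+ 0))) ∎
      where open ≡-Reasoning

  -- The index has the form 8 + j so that the shifts by 2 and 8 reduce by computation.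
  p-eu^od-even : ∀ j → conv lower-even (p (2 ℕ.* (8 ℕ.+ j))) (8 ℕ.+ j) ≤ + p-eu^od (2 ℕ.* (8 ℕ.+ j))
  p-eu^od-even j = p-eu^od-three-stairs (2 ℕ.* (8 ℕ.+ j)) 2 8 (8 ℕ.+ j) (6 ℕ.+ j) j 0 2 4
    (((λ ()) ∷ (λ ()) ∷ []) ∷ ((λ ()) ∷ []) ∷ [] ∷ [])
    (refl ∷ eq₁ j ∷ eq₂ j ∷ [])
    (8 ℕ.+ j) refl refl refl
    where
    eq₁ : ∀ j → 4 ℕ.+ 2 ℕ.* (6 ℕ.+ j) ≡ 2 ℕ.* (8 ℕ.+ j)
    eq₁ = ℕ-Solver.solve-∀
    eq₂ : ∀ j → 16 ℕ.+ 2 ℕ.* j ≡ 2 ℕ.* (8 ℕ.+ j)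
    eq₂ = ℕ-Solver.solve-∀

  p-eu^od-odd : ∀ j → conv lower-odd (p (suc (2 ℕ.* (12 ℕ.+ j)))) (12 ℕ.+ j) ≤ + p-eu^od (suc (2 ℕ.* (12 ℕ.+ j)))
  p-eu^od-odd j = p-eu^od-three-stairs (suc (2 ℕ.* (12 ℕ.+ j))) 4 12 (12 ℕ.+ j) (8 ℕ.+ j) j 1 3 5
    (((λ ()) ∷ (λ ()) ∷ []) ∷ ((λ ()) ∷ []) ∷ [] ∷ [])
    (refl ∷ eq₁ j ∷ eq₂ j ∷ [])
    (12 ℕ.+ j) refl refl refl
    where
    eq₁ : ∀ j → 9 ℕ.+ 2 ℕ.* (8 ℕ.+ j) ≡ suc (2 ℕ.* (12 ℕ.+ j))
    eq₁ = ℕ-Solver.solve-∀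
    eq₂ : ∀ j → 25 ℕ.+ 2 ℕ.* j ≡ suc (2 ℕ.* (12 ℕ.+ j))
    eq₂ = ℕ-Solver.solve-∀

  -- Positivity of the gap and conclusion.

  squeeze : ∀ lower upper f n {a b} → 1ℤ ≤ conv (lower +ₚ - 1ℤ ·ₚ upper) f n →
            + a ≤ conv upper f n → conv lower f n ≤ + b → a < b
  squeeze lower upper f n {a} {b} gap a≤ ≤b = ℤ.drop‿+≤+ (begin
    1ℤ + + a                                          ≤⟨ ℤ.+-mono-≤ gap a≤ ⟩
    conv (lower +ₚ - 1ℤ ·ₚ upper) f n + conv upper f n ≡⟨ cong (_+ conv upper f n)
        (trans (conv-+ₚ lower (- 1ℤ ·ₚ upper) f n) (cong (λ z → conv lower f n + z) (conv-·ₚ (- 1ℤ) upper f n))) ⟩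
    conv lower f n + - 1ℤ * conv upper f n + conv upper f n ≡⟨ eq (conv lower f n) (conv upper f n) ⟩
    conv lower f n                                    ≤⟨ ≤b ⟩
    + b                                               ∎)
    where
    open ℤ.≤-Reasoning
    eq : ∀ x y → x + - 1ℤ * y + y ≡ x
    eq = solve-∀

  140≤half : ∀ {e m} → e ℕ.≤ 1 → 373 ℕ.≤ e ℕ.+ 2 ℕ.* m → 140 ℕ.≤ m
  -- Removing e leaves 372 ≤ 2m, and 372 = 280 + 92 with 280 = 2 · 140, twice the index from which
  -- the certificates hold.
  140≤half {e} {m} e≤1 n≥ = ℕ.*-cancelˡ-≤ 2 (ℕ.≤-trans (ℕ.m≤m+n 280 92)
    (ℕ.≤-pred (ℕ.≤-trans n≥ (ℕ.+-monoˡ-≤ (2 ℕ.* m) e≤1))))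

  20≤double : ∀ {m n} → 140 ℕ.≤ m → 2 ℕ.* m ℕ.≤ n → 20 ℕ.≤ n
  20≤double {m} m≥ 2m≤n = ℕ.≤-trans (ℕ.≤-trans (ℕ.m≤m+n 20 120) m≥) (ℕ.≤-trans (ℕ.m≤m+n m _) 2m≤n)

  -- Found by computing the table for both polynomials.
  open Certificate 140 19 10000000

  -- Type checking `tt` evaluates the table: levels 0 to 140 with 160 coefficients each. The reserve
  -- demanded at level 20 is 1 + 140 · 10⁷.
  gap-even : ∀ k n → 20 ℕ.≤ k → 140 ℕ.≤ n → 1ℤ ≤ conv (lower-even +ₚ - 1ℤ ·ₚ upper-even) (p k) n
  gap-even = certified-positive (lower-even +ₚ - 1ℤ ·ₚ upper-even) tt

  gap-odd : ∀ k n → 20 ℕ.≤ k → 140 ℕ.≤ n → 1ℤ ≤ conv (lower-odd +ₚ - 1ℤ ·ₚ upper-odd) (p k) n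
  gap-odd = certified-positive (lower-odd +ₚ - 1ℤ ·ₚ upper-odd) tt

  main : ∀ n → n ≥ 373 → p-od^eu n < p-eu^od n
  main n n≥ with parity n
  ... | even m = squeeze lower-even upper-even (p (2 ℕ.* m)) m
      (gap-even (2 ℕ.* m) m (20≤double m≥ ℕ.≤-refl) m≥)
      (p-od^eu-even m (ℕ.≤-trans (ℕ.m≤m+n 2 138) m≥))
      (subst (λ m → conv lower-even (p (2 ℕ.* m)) m ≤ + p-eu^od (2 ℕ.* m))
        (ℕ.m+[n∸m]≡n (ℕ.≤-trans (ℕ.m≤m+n 8 132) m≥)) (p-eu^od-even (m ℕ.∸ 8)))
    where m≥ = 140≤half {0} z≤n n≥
  ... | odd m = squeeze lower-odd upper-odd (p (suc (2 ℕ.* m))) m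
      (gap-odd (suc (2 ℕ.* m)) m (20≤double m≥ (ℕ.n≤1+n _)) m≥)
      (p-od^eu-odd m (ℕ.≤-trans (ℕ.m≤m+n 1 139) m≥))
      (subst (λ m → conv lower-odd (p (suc (2 ℕ.* m))) m ≤ + p-eu^od (suc (2 ℕ.* m)))
        (ℕ.m+[n∸m]≡n (ℕ.≤-trans (ℕ.m≤m+n 12 128) m≥)) (p-eu^od-odd (m ℕ.∸ 12)))
    where m≥ = 140≤half {1} (s≤s z≤n) n≥

theorem1p2 : (n : ℕ) → n ≥ 373 → p-od^eu n < p-eu^od n
theorem1p2 = Comparison.main
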